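{- For every graph $F$ of diameter $2$, there exist infinitely many (pairwise non-isomorphic) graphs $G$ of diameter $3$ that are $F$-irregular.
   Context: All graphs are finite, simple and undirected. For graphs $F$ and $G$ and a vertex $v$ of $G$, the $F$-degree of $v$ in $G$ is the number of subgraphs of $G$ (not necessarily induced) that are isomorphic to $F$ and contain $v$. A graph $G$ is called $F$-irregular if any two distinct vertices of $G$ have different $F$-degrees in $G$. -}

module Defs where

open import Data.Nat using (ℕ; zero; suc; _≤_)
open import Data.Bool using (Bool; true; false; T)
open import Data.Fin using (Fin)
open import Data.Vec using (Vec; lookup)
open import Data.Product using (Σ; _×_; ∃; ∃-syntax; _,_)
open import Relation.Binary.PropositionalEquality using (_≡_; _≢_)
open import Function.Bundles using (_↔_; Inverse)
open import Relation.Nullary using (¬_)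

record Graph : Set where
  field
    n      : ℕ
    adj    : Fin n → Fin n → Bool
    sym    : ∀ i j → adj i j ≡ adj j i
    irrefl : ∀ i → adj i i ≡ false
open Graph public

record _≅_ (G H : Graph) : Set where
  field
    bij  : Fin (n G) ↔ Fin (n H)
    pres : ∀ i j → adj G i j ≡ adj H (Inverse.to bij i) (Inverse.to bij j)

data Walk (G : Graph) : Fin (n G) → Fin (n G) → ℕ → Set where
  here : ∀ {u} → Walk G u u zero
  step : ∀ {u w v k} → adj G u w ≡ true → Walk G w v k → Walk G u v (suc k)

DistLe : (G : Graph) → Fin (n G) → Fin (n G) → ℕ → Set
DistLe G u v d = ∃[ j ] (j ≤ d × Walk G u v j)

HasDiameter : Graph → ℕ → Set
HasDiameter G d =
  (∀ u v → DistLe G u v d) ×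
  (∃[ u ] ∃[ v ] (∀ j → Walk G u v j → d ≤ j))

-- A subgraph (not necessarily induced) of G: a vertex subset S and an edge
-- set E (symmetric Boolean matrix), with E ⊆ E(G) and every edge of E having
-- both ends in S. Side conditions are irrelevant fields so that subgraphs are
-- identified exactly by (S , E).
record Subgraph (G : Graph) : Set where
  constructor sub
  field
    S : Vec Bool (n G)
    E : Vec (Vec Bool (n G)) (n G)
    .E-sym : ∀ i j → lookup (lookup E i) j ≡ lookup (lookup E j) i
    .E⊆G   : ∀ i j → lookup (lookup E i) j ≡ true → adj G i j ≡ true
    .E⊆S   : ∀ i j → lookup (lookup E i) j ≡ true → lookup S i ≡ true
open Subgraph public

IsoToSub : (F G : Graph) → Subgraph G → Set
IsoToSub F G H =
  Σ (Fin (n F) → Fin (n G)) λ f →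
    (∀ a b → f a ≡ f b → a ≡ b) ×
    (∀ i → lookup (S H) i ≡ true → ∃[ a ] (f a ≡ i)) ×
    (∀ a → lookup (S H) (f a) ≡ true) ×
    (∀ a b → adj F a b ≡ lookup (lookup (E H) (f a)) (f b))

record FCopyAt (F G : Graph) (v : Fin (n G)) : Set where
  constructor copy
  field
    H     : Subgraph G
    .iso  : IsoToSub F G H
    .memb : lookup (S H) v ≡ true

FDegreeIs : (F G : Graph) → Fin (n G) → ℕ → Set
FDegreeIs F G v k = Fin k ↔ FCopyAt F G v

FIrregular : (F G : Graph) → Set
FIrregular F G =
  ∀ u w k l → FDegreeIs F G u k → FDegreeIs F G w l → u ≢ w → k ≢ l

{-# OPTIONS --safe #-}

-- Take cliques A and B of size ℓ with A i ~ B j iff ℓ ≤ i + j (indices from 0), a vertex T adjacent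
-- to all of them, and a vertex D adjacent to A 0, …, A (s - 1) only. The diameter is 3, and the
-- F-degrees increase along D, B 0, A 0, B 1, A 1, …, T. Degrees are compared by injections between
-- sets of copies that miss a copy.
--
-- Swapping A and B is a symmetry of G - D, so B i and A i lie in equally many copies avoiding D.
-- A copy through D has diameter at most 2, hence stays so close to D that B i can be replaced in it
-- by A i, but not conversely. Passing from A i to B (i + 1) gains the copies that use the edge
-- between B (i + 1) and A (ℓ - 1 - i); it loses the copies through D, which are fewer. If F has a
-- leaf, take s = 1: the copies through D then embed explicitly among those gained. Otherwise take
-- s = |F| = m: a copy through D contains two of the s neighbours of D, leaving O(ℓ^(m - 3)) of them,
-- whereas the gain is of order ℓ^(m - 2).

module Submission where

open import Defs
open import Data.Nat using (ℕ)
open import Data.Product using (Σ; _×_)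
open import Relation.Binary.PropositionalEquality using (_≢_)
open import Relation.Nullary using (¬_)

open import Data.Bool using (Bool; true; false; not; if_then_else_)
import Data.Bool.Properties as Bool
open import Data.Empty using (⊥; ⊥-elim)
open import Data.Fin as Fin using
  ( Fin; zero; suc; toℕ; fromℕ; fromℕ<; inject₁; inject≤; opposite; punchIn; punchOut
  ; combine; finToFun; funToFin; splitAt; _↑ˡ_; _↑ʳ_)
open import Data.Fin.Permutation using (↔⇒≡)
open import Data.Fin.Properties as Fin using (any?; all?; finToFun-funToFin; injective⇒≤)
open import Data.Maybe using (Maybe; just; nothing)
open import Data.Maybe.Properties using (just-injective)
open import Data.Nat as ℕ using (zero; suc; _+_; _*_; _≤_; _<_; z≤n; s≤s)
import Data.Nat.Properties as ℕ
open import Algebra.Properties.CommutativeSemigroup ℕ.+-commutativeSemigroup using (interchange)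
open import Data.Product using (_,_; proj₁; proj₂; ∃-syntax)
open import Data.Sum using (_⊎_; inj₁; inj₂; [_,_]′)
open import Data.Vec using (Vec; lookup; tabulate)
open import Data.Vec.Functional using (insertAt)
open import Data.Vec.Functional.Properties using (insertAt-punchIn)
open import Data.Vec.Properties using (lookup∘tabulate; tabulate∘lookup; tabulate-cong)
open import Function using (_∘_; _↔_; _↣_; mk↣; mk↔ₛ′; Inverse; Injection)
open import Function.Construct.Composition using (_↔-∘_)
open import Function.Properties.Inverse using (↔⇒↣; ↔-sym)
open import Relation.Binary.Definitions using (DecidableEquality; tri<; tri≈; tri>)
open import Relation.Binary.PropositionalEquality as ≡ using (_≡_; refl; cong; cong₂; subst; trans)
open import Relation.Nullary using (Dec; yes; no; does; contradiction)
open import Relation.Nullary.Decidable using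
  (recompute; map′; toSum; dec-true; dec-false; ¬?; _×-dec_; _→-dec_)

-- The closed neighbourhoods of the `B i` grow with i, which orders their degrees, but without D
-- each `B i` would tie with its mirror image `A i`. D is there to break these ties, and the
-- difficulty is that it must not reverse the inequality between `A i` and `B (i + 1)`. This
-- dictates s. If F has no leaf, a vertex D with a single neighbour would lie in no copy and all
-- ties would remain; with m neighbours, D can take the role of any vertex of F. If F has a leaf, D
-- may be that leaf, and then only one further vertex of the copy is forced to be near D. For large
-- s the copies through D can then be of the same order ℓ^(m - 2) as the gain, so that comparing
-- orders decides nothing. With s = 1 these copies are so restricted that they can be moved one by
-- one.

true≢false : ∀ {b : Bool} → b ≡ true → b ≡ false → ⊥
true≢false refl ()

bool-ext : ∀ {b c : Bool} → (b ≡ true → c ≡ true) → (c ≡ true → b ≡ true) → b ≡ c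
bool-ext {true}  {true}  _ _ = refl
bool-ext {true}  {false} f _ = ≡.sym (f refl)
bool-ext {false} {true}  _ g = g refl
bool-ext {false} {false} _ _ = refl

does-true : ∀ {a} {A : Set a} (a? : Dec A) → does a? ≡ true → A
does-true (yes a) _ = a

module _ {A : Set} (_≟_ : DecidableEquality A) where

  swap : A → A → A → A
  swap x y z = if does (z ≟ x) then y else (if does (z ≟ y) then x else z)

  swap-left : ∀ x y → swap x y x ≡ y
  swap-left x y rewrite dec-true (x ≟ x) refl = refl

  swap-right : ∀ x y → swap x y y ≡ x
  swap-right x y with y ≟ x
  ... | yes y≡x = y≡x
  ... | no _ rewrite dec-true (y ≟ y) refl = refl

  swap-other : ∀ x y {z} → z ≢ x → z ≢ y → swap x y z ≡ z
  swap-other x y {z} z≢x z≢y rewrite dec-false (z ≟ x) z≢x | dec-false (z ≟ y) z≢y = refl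

  swap-involutive : ∀ x y z → swap x y (swap x y z) ≡ z
  swap-involutive x y z with z ≟ x
  ... | yes refl = swap-right x y
  ... | no z≢x with z ≟ y
  ...   | yes refl = swap-left x y
  ...   | no z≢y = swap-other x y z≢x z≢y

  swap↔ : A → A → A ↔ A
  swap↔ x y = mk↔ₛ′ (swap x y) (swap x y) (swap-involutive x y) (swap-involutive x y)

glue : ∀ {X Y : Set} (t : X → Bool)
  (f : ∀ x → t x ≡ true → Y) (g : ∀ x → t x ≡ false → Y) →
  (∀ x x′ p p′ → f x p ≡ f x′ p′ → x ≡ x′) →
  (∀ x x′ p p′ → g x p ≡ g x′ p′ → x ≡ x′) →
  (∀ x x′ p p′ → f x p ≢ g x′ p′) → X ↣ Y
glue {X} {Y} t f g f-inj g-inj f≢g = mk↣ {to = h} λ {x} {x′} → h-inj x x′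
  where
  -- The value of the test is an argument of its own, so that injectivity follows by matching on two
  -- Booleans although the proofs depend on `t x`.
  branch : ∀ x b → t x ≡ b → Y
  branch x true  = f x
  branch x false = g x

  h : X → Y
  h x = branch x (t x) refl

  branch-inj : ∀ x x′ b b′ p p′ → branch x b p ≡ branch x′ b′ p′ → x ≡ x′
  branch-inj x x′ true  true  p p′ e = f-inj x x′ p p′ e
  branch-inj x x′ true  false p p′ e = contradiction e (f≢g x x′ p p′)
  branch-inj x x′ false true  p p′ e = contradiction (≡.sym e) (f≢g x′ x p′ p)
  branch-inj x x′ false false p p′ e = g-inj x x′ p p′ e

  h-inj : ∀ x x′ → h x ≡ h x′ → x ≡ x′
  h-inj x x′ = branch-inj x x′ (t x) (t x′) refl refl

adjoin : ∀ {X Y : Set} (y : Y) (f : X → Y) → (∀ x x′ → f x ≡ f x′ → x ≡ x′) →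
  (∀ x → f x ≢ y) → Maybe X ↣ Y
adjoin {X} {Y} y f f-inj f≢y = mk↣ {to = h} λ {x} {x′} → h-inj x x′
  where
  h : Maybe X → Y
  h nothing  = y
  h (just x) = f x

  h-inj : ∀ x x′ → h x ≡ h x′ → x ≡ x′
  h-inj nothing  nothing   _ = refl
  h-inj nothing  (just x′) e = contradiction (≡.sym e) (f≢y x′)
  h-inj (just x) nothing   e = contradiction e (f≢y x)
  h-inj (just x) (just x′) e = cong just (f-inj x x′ e)

lookup-ext : ∀ {A : Set} {k} {xs ys : Vec A k} → (∀ i → lookup xs i ≡ lookup ys i) → xs ≡ ys
lookup-ext {xs = xs} {ys} e =
  trans (≡.sym (tabulate∘lookup xs)) (trans (tabulate-cong e) (tabulate∘lookup ys))

adj⇒≢ : ∀ (F : Graph) {a b} → adj F a b ≡ true → a ≢ b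
adj⇒≢ F {a} ab refl = true≢false ab (irrefl F a)

adj-sym : ∀ (F : Graph) {a b} → adj F a b ≡ true → adj F b a ≡ true
adj-sym F {a} {b} ab = trans (sym F b a) ab

swap-injective : ∀ {A : Set} (_≟_ : DecidableEquality A) x y {u v} →
  swap _≟_ x y u ≡ swap _≟_ x y v → u ≡ v
swap-injective _≟_ x y = Injection.injective (↔⇒↣ (swap↔ _≟_ x y))

swap-closed : ∀ {A : Set} (_≟_ : DecidableEquality A) (P : A → Set) {x y z} →
  P x → P y → P z → P (swap _≟_ x y z)
swap-closed _≟_ P {x} {y} {z} px py pz with z ≟ x
... | yes _ = py
... | no _ with z ≟ y
...   | yes _ = px
...   | no _ = pz

chain : ∀ {k} (R : Fin k → Fin k → Set) → (∀ {a b c} → R a b → R b c → R a c) →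
  (∀ {a b} → toℕ b ≡ suc (toℕ a) → R a b) → ∀ {a b} → toℕ a < toℕ b → R a b
chain {suc k} R R-trans next {zero}  {suc zero}    _ = next refl
chain {suc k} R R-trans next {zero}  {suc (suc b)} _ =
  R-trans (next refl)
    (chain (λ a b → R (suc a) (suc b)) R-trans (next ∘ cong suc) {zero} {suc b} (s≤s z≤n))
chain {suc k} R R-trans next {suc a} {suc b} (s≤s a<b) =
  chain (λ a b → R (suc a) (suc b)) R-trans (next ∘ cong suc) a<b

opposite-sum : ∀ {k} (i : Fin (suc k)) → toℕ (opposite i) + toℕ i ≡ k
opposite-sum {k} i = trans (cong (_+ toℕ i) (Fin.opposite-prop i)) (ℕ.m∸n+n≡m (Fin.toℕ≤pred[n] i))

opposite-injective : ∀ {k} {i j : Fin k} → opposite i ≡ opposite j → i ≡ j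
opposite-injective {i = i} {j} e =
  trans (≡.sym (Fin.opposite-involutive i)) (trans (cong opposite e) (Fin.opposite-involutive j))

punchIn-inject₁ : ∀ {k} (p : Fin k) → punchIn (inject₁ p) p ≡ suc p
punchIn-inject₁ zero    = refl
punchIn-inject₁ (suc p) = cong suc (punchIn-inject₁ p)

-- Once position p is removed, position p + 1 becomes number p; skipping p twice therefore leaves
-- out both.
bypass : ∀ {k} → Fin (suc k) → Fin k → Fin (suc (suc k))
bypass p i = punchIn (inject₁ p) (punchIn p i)

bypass≢inject₁ : ∀ {k} (p : Fin (suc k)) i → bypass p i ≢ inject₁ p
bypass≢inject₁ p i = Fin.punchInᵢ≢i (inject₁ p) (punchIn p i)

bypass≢suc : ∀ {k} (p : Fin (suc k)) i → bypass p i ≢ suc p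
bypass≢suc p i e = Fin.punchInᵢ≢i p i
  (Fin.punchIn-injective (inject₁ p) _ _ (trans e (≡.sym (punchIn-inject₁ p))))

bypass-injective : ∀ {k} (p : Fin (suc k)) {i j} → bypass p i ≡ bypass p j → i ≡ j
bypass-injective p e = Fin.punchIn-injective p _ _ (Fin.punchIn-injective (inject₁ p) _ _ e)

inject₁≢suc : ∀ {k} (p : Fin k) → inject₁ p ≢ suc p
inject₁≢suc (suc p) e = inject₁≢suc p (Fin.suc-injective e)

-- The points x and y go to the consecutive positions p and p + 1, and any other point a to an
-- arbitrary position of the a-th of m disjoint blocks of size q.
module Spread {m q : ℕ} {x y : Fin m} (x≢y : x ≢ y) (p : Fin (suc (m * q))) where

  spread : (Fin m → Fin q) → Fin m → Fin (2 + m * q)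
  spread z a with a Fin.≟ x | a Fin.≟ y
  ... | yes _ | _     = inject₁ p
  ... | no _  | yes _ = suc p
  ... | no _  | no _  = bypass p (combine a (z a))

  spread-x : ∀ z → spread z x ≡ inject₁ p
  spread-x z with x Fin.≟ x
  ... | yes _  = refl
  ... | no x≢x = contradiction refl x≢x

  spread-y : ∀ z → spread z y ≡ suc p
  spread-y z with y Fin.≟ x | y Fin.≟ y
  ... | yes y≡x | _      = contradiction (≡.sym y≡x) x≢y
  ... | no _    | yes _  = refl
  ... | no _    | no y≢y = contradiction refl y≢y

  -- The blocks are disjoint and miss p and p + 1, so a position reveals the point it comes from.
  -- Hence the vertex set of a placed copy already reveals the choices z, and automorphisms of F
  -- cause no double counting.
  spread-determines : ∀ z z′ {a b} → spread z a ≡ spread z′ b →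
    a ≡ b × (a ≢ x → a ≢ y → z a ≡ z′ a)
  spread-determines z z′ {a} {b} e with a Fin.≟ x | a Fin.≟ y | b Fin.≟ x | b Fin.≟ y
  ... | yes a≡x | _       | yes b≡x | _       = trans a≡x (≡.sym b≡x) , λ a≢x → contradiction a≡x a≢x
  ... | yes _   | _       | no _    | yes _   = contradiction e (inject₁≢suc p)
  ... | yes _   | _       | no _    | no _    = contradiction (≡.sym e) (bypass≢inject₁ p _)
  ... | no _    | yes _   | yes _   | _       = contradiction (≡.sym e) (inject₁≢suc p)
  ... | no _    | yes a≡y | no _    | yes b≡y = trans a≡y (≡.sym b≡y) , λ _ a≢y → contradiction a≡y a≢y
  ... | no _    | yes _   | no _    | no _    = contradiction (≡.sym e) (bypass≢suc p _)
  ... | no _    | no _    | yes _   | _       = contradiction e (bypass≢inject₁ p _)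
  ... | no _    | no _    | no _    | yes _   = contradiction e (bypass≢suc p _)
  ... | no _    | no _    | no _    | no _
    with refl , za≡ ← Fin.combine-injective a (z a) b (z′ b) (bypass-injective p e) =
      refl , λ _ _ → za≡

  spread-injective : ∀ z {a b} → spread z a ≡ spread z b → a ≡ b
  spread-injective z e = spread-determines z z e .proj₁


-- Coding functions by numbers; omitting two or three points

funToFin-cong : ∀ {k q} {f g : Fin k → Fin q} → (∀ i → f i ≡ g i) → funToFin f ≡ funToFin g
funToFin-cong {zero}  e = refl
funToFin-cong {suc k} e = cong₂ combine (e zero) (funToFin-cong (e ∘ suc))

finToFun-injective : ∀ {k q} {c d : Fin (q ℕ.^ k)} →
  (∀ i → finToFun {q} {k} c i ≡ finToFun {q} {k} d i) → c ≡ d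
finToFun-injective {k} {q} {c} {d} e = trans (≡.sym (Fin.funToFin-finToFin {k} {q} c))
  (trans (funToFin-cong e) (Fin.funToFin-finToFin {k} {q} d))

-- The size enters through an equation because it will be `n F`, which is not a successor by
-- computation.
omit₂ : ∀ {m k} → m ≡ 2 + k → {x y : Fin m} → x ≢ y → Fin k → Fin m
omit₂ refl {x} x≢y j = punchIn x (punchIn (punchOut x≢y) j)

omit₂-cover : ∀ {m k} (m≡ : m ≡ 2 + k) {x y : Fin m} (x≢y : x ≢ y) a →
  a ≡ x ⊎ a ≡ y ⊎ ∃[ j ] omit₂ m≡ x≢y j ≡ a
omit₂-cover refl {x} {y} x≢y a with x Fin.≟ a | y Fin.≟ a
... | yes x≡a | _       = inj₁ (≡.sym x≡a)
... | no _    | yes y≡a = inj₂ (inj₁ (≡.sym y≡a))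
... | no x≢a  | no y≢a  = inj₂ (inj₂ (punchOut y′≢a′ ,
  trans (cong (punchIn x) (Fin.punchIn-punchOut y′≢a′)) (Fin.punchIn-punchOut x≢a)))
  where
  y′≢a′ : punchOut x≢y ≢ punchOut x≢a
  y′≢a′ = y≢a ∘ Fin.punchOut-injective x≢y x≢a

omit₂≢ˡ : ∀ {m k} (m≡ : m ≡ 2 + k) {x y : Fin m} (x≢y : x ≢ y) j → omit₂ m≡ x≢y j ≢ x
omit₂≢ˡ refl {x} x≢y j = Fin.punchInᵢ≢i x _

omit₂≢ʳ : ∀ {m k} (m≡ : m ≡ 2 + k) {x y : Fin m} (x≢y : x ≢ y) j → omit₂ m≡ x≢y j ≢ y
omit₂≢ʳ refl {x} x≢y j e = Fin.punchInᵢ≢i (punchOut x≢y) j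
  (Fin.punchIn-injective x _ _ (trans e (≡.sym (Fin.punchIn-punchOut x≢y))))

-- The value d at x and y is a dummy: `spread` sends these two points to fixed positions.
extend₂ : ∀ {m k} → m ≡ 2 + k → {x y : Fin m} → x ≢ y →
  ∀ {q} → Fin q → (Fin k → Fin q) → Fin m → Fin q
extend₂ refl {x} x≢y d f = insertAt (insertAt f (punchOut x≢y) d) x d

extend₂-omit₂ : ∀ {m k} (m≡ : m ≡ 2 + k) {x y : Fin m} (x≢y : x ≢ y) {q} (d : Fin q) f j →
  extend₂ m≡ x≢y d f (omit₂ m≡ x≢y j) ≡ f j
extend₂-omit₂ refl {x} x≢y d f j = trans
  (insertAt-punchIn (insertAt f (punchOut x≢y) d) x d (punchIn (punchOut x≢y) j))
  (insertAt-punchIn f (punchOut x≢y) d j)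

omit₃ : ∀ {m k} → m ≡ 3 + k → {x y z : Fin m} → x ≢ y → x ≢ z → y ≢ z → Fin k → Fin m
omit₃ refl {x} x≢y x≢z y≢z j =
  punchIn x (omit₂ refl (y≢z ∘ Fin.punchOut-injective x≢y x≢z) j)

omit₃-cover : ∀ {m k} (m≡ : m ≡ 3 + k) {x y z : Fin m} (x≢y : x ≢ y) (x≢z : x ≢ z) (y≢z : y ≢ z) a →
  a ≡ x ⊎ a ≡ y ⊎ a ≡ z ⊎ ∃[ j ] omit₃ m≡ x≢y x≢z y≢z j ≡ a
omit₃-cover refl {x} x≢y x≢z y≢z a with x Fin.≟ a
... | yes x≡a = inj₁ (≡.sym x≡a)
... | no x≢a with omit₂-cover refl (y≢z ∘ Fin.punchOut-injective x≢y x≢z) (punchOut x≢a)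
...   | inj₁ e              = inj₂ (inj₁ (Fin.punchOut-injective x≢a x≢y e))
...   | inj₂ (inj₁ e)       = inj₂ (inj₂ (inj₁ (Fin.punchOut-injective x≢a x≢z e)))
...   | inj₂ (inj₂ (j , e)) = inj₂ (inj₂ (inj₂ (j ,
  trans (cong (punchIn x) e) (Fin.punchIn-punchOut x≢a))))

three-distinct : ∀ {m} {a b c : Fin m} → a ≢ b → a ≢ c → b ≢ c → ∃[ k ] m ≡ 3 + k
three-distinct {suc zero} a≢b _ _ with () ← punchOut a≢b
three-distinct {suc (suc zero)} a≢b a≢c b≢c with () ← punchOut (b≢c ∘ Fin.punchOut-injective a≢b a≢c)
three-distinct {suc (suc (suc k))} _ _ _ = k , refl

n+n-injective : ∀ {m n} → m + m ≡ n + n → m ≡ n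
n+n-injective {m} {n} e with ℕ.<-cmp m n
... | tri< m<n _ _ = contradiction e (ℕ.<⇒≢ (ℕ.+-mono-< m<n m<n))
... | tri≈ _ m≡n _ = m≡n
... | tri> _ _ n<m = contradiction (≡.sym e) (ℕ.<⇒≢ (ℕ.+-mono-< n<m n<m))

-- Estimates for the count in the leafless case

times⁵ : ℕ → ℕ → ℕ
times⁵ m x = m * (m * (m * (m * (m * x))))

times⁵-mono : ∀ m {x y} → x ≤ y → times⁵ m x ≤ times⁵ m y
times⁵-mono m = up ∘ up ∘ up ∘ up ∘ up
  where
  up : ∀ {x y} → x ≤ y → m * x ≤ m * y
  up = ℕ.*-monoʳ-≤ m

times⁵-assoc : ∀ m x y → times⁵ m (x * y) ≡ times⁵ m x * y
times⁵-assoc m x y = pull (pull (pull (pull (pull refl))))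
  where
  pull : ∀ {z w} → z ≡ w * y → m * z ≡ m * w * y
  pull {w = w} e = trans (cong (m *_) e) (≡.sym (ℕ.*-assoc m w y))

^-distribʳ-* : ∀ k x y → (x * y) ℕ.^ k ≡ x ℕ.^ k * y ℕ.^ k
^-distribʳ-* zero    x y = refl
^-distribʳ-* (suc k) x y = trans (cong (x * y *_) (^-distribʳ-* k x y))
  (ℕ.[m*n]*[o*p]≡[m*o]*[n*p] x y (x ℕ.^ k) (y ℕ.^ k))

-- The left side is the order of the graph to be built with ℓ = 2 + m * q; it is thus linear in q.
order≤ : ∀ m q → 0 < q → 2 + ((2 + m * q) + (2 + m * q)) ≤ (6 + (m + m)) * q
order≤ m q 0<q = begin
  2 + ((2 + m * q) + (2 + m * q))  ≡⟨ cong (λ x → 4 + x) (ℕ.+-comm (m * q) (2 + m * q)) ⟩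
  6 + (m * q + m * q)              ≤⟨ ℕ.+-monoˡ-≤ _ (ℕ.m≤m*n 6 q {{ℕ.>-nonZero 0<q}}) ⟩
  6 * q + (m * q + m * q)          ≡⟨ cong (6 * q +_) (ℕ.*-distribʳ-+ q m m) ⟨
  6 * q + (m + m) * q              ≡⟨ ℕ.*-distribʳ-+ q 6 (m + m) ⟨
  (6 + (m + m)) * q                ∎
  where open ℕ.≤-Reasoning

-- A copy through D will be coded by five numbers below m and k arbitrary vertices, whereas a stair
-- leaves k + 1 free choices out of q. The additional factor q outweighs the constant.
roomy : ∀ m k q → times⁵ m ((6 + (m + m)) ℕ.^ k) < q →
  times⁵ m ((2 + ((2 + m * q) + (2 + m * q))) ℕ.^ k) < q ℕ.^ suc k
roomy m k q M<q = begin-strict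
  times⁵ m ((2 + ((2 + m * q) + (2 + m * q))) ℕ.^ k)
    ≤⟨ times⁵-mono m (ℕ.^-monoˡ-≤ k (order≤ m q 0<q)) ⟩
  times⁵ m (((6 + (m + m)) * q) ℕ.^ k)         ≡⟨ cong (times⁵ m) (^-distribʳ-* k (6 + (m + m)) q) ⟩
  times⁵ m ((6 + (m + m)) ℕ.^ k * q ℕ.^ k)     ≡⟨ times⁵-assoc m ((6 + (m + m)) ℕ.^ k) (q ℕ.^ k) ⟩
  times⁵ m ((6 + (m + m)) ℕ.^ k) * q ℕ.^ k
    <⟨ ℕ.*-monoˡ-< (q ℕ.^ k) {{ℕ.m^n≢0 q k {{ℕ.>-nonZero 0<q}}}} M<q ⟩
  q * q ℕ.^ k                                  ∎
  where
  open ℕ.≤-Reasoning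
  0<q : 0 < q
  0<q = ℕ.≤-<-trans z≤n M<q

-- Copies of F in a graph

module Copies (F : Graph) {V : Set} {N : ℕ}
  (enc : V → Fin N) (dec : Fin N → V)
  (dec-enc : ∀ v → dec (enc v) ≡ v) (enc-dec : ∀ i → enc (dec i) ≡ i)
  (_~_ : V → V → Bool)
  (~-sym : ∀ u v → (u ~ v) ≡ (v ~ u)) (~-irrefl : ∀ v → (v ~ v) ≡ false) where

  G : Graph
  G = record
    { n      = N
    ; adj    = λ i j → dec i ~ dec j
    ; sym    = λ i j → ~-sym (dec i) (dec j)
    ; irrefl = λ i → ~-irrefl (dec i)
    }

  enc-injective : ∀ {u v} → enc u ≡ enc v → u ≡ v
  enc-injective {u} {v} e = trans (≡.sym (dec-enc u)) (trans (cong dec e) (dec-enc v))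

  dec-injective : ∀ {i j} → dec i ≡ dec j → i ≡ j
  dec-injective {i} {j} e = trans (≡.sym (enc-dec i)) (trans (cong enc e) (enc-dec j))

  _≟_ : DecidableEquality V
  u ≟ v = map′ enc-injective (cong enc) (enc u Fin.≟ enc v)

  mem : Subgraph G → V → Bool
  mem H v = lookup (S H) (enc v)

  edge : Subgraph G → V → V → Bool
  edge H u v = lookup (lookup (E H) (enc u)) (enc v)

  Copy : V → Set
  Copy v = FCopyAt F G (enc v)

  host : ∀ {v} → Copy v → Subgraph G
  host = FCopyAt.H

  subgraph-ext : ∀ {H H′} → (∀ v → mem H v ≡ mem H′ v) →
    (∀ u v → edge H u v ≡ edge H′ u v) → H ≡ H′
  subgraph-ext {H} {H′} mem≡ edge≡ =
    go (lookup-ext λ i → subst (λ k → lookup (S H) k ≡ lookup (S H′) k) (enc-dec i) (mem≡ (dec i)))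
       (lookup-ext λ i → lookup-ext λ j →
          ≡.subst₂ (λ k l → lookup (lookup (E H) k) l ≡ lookup (lookup (E H′) k) l)
            (enc-dec i) (enc-dec j) (edge≡ (dec i) (dec j)))
    where
    go : S H ≡ S H′ → E H ≡ E H′ → H ≡ H′
    go refl refl = refl

  copy-ext : ∀ {v} {P Q : Copy v} → host P ≡ host Q → P ≡ Q
  copy-ext refl = refl

  edge-sym : ∀ H {u v} → edge H u v ≡ true → edge H v u ≡ true
  edge-sym (sub S E E-sym _ _) {u} {v} p =
    recompute (_ Bool.≟ true) (trans (E-sym (enc v) (enc u)) p)

  edge⇒~ : ∀ H {u v} → edge H u v ≡ true → (u ~ v) ≡ true
  edge⇒~ (sub S E _ E⊆G _) {u} {v} p = recompute (_ Bool.≟ true)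
    (≡.subst₂ (λ x y → (x ~ y) ≡ true) (dec-enc u) (dec-enc v) (E⊆G (enc u) (enc v) p))

  edge⇒memˡ : ∀ H {u v} → edge H u v ≡ true → mem H u ≡ true
  edge⇒memˡ (sub S E _ _ E⊆S) p = recompute (_ Bool.≟ true) (E⊆S _ _ p)

  edge⇒memʳ : ∀ H {u v} → edge H u v ≡ true → mem H v ≡ true
  edge⇒memʳ H p = edge⇒memˡ H (edge-sym H p)

  memb : ∀ {v} (P : Copy v) → mem (host P) v ≡ true
  memb (copy _ _ m) = recompute (_ Bool.≟ true) m

  Embeds : Subgraph G → (Fin (n F) → Fin N) → Set
  Embeds H f =
    (∀ a b → f a ≡ f b → a ≡ b) ×
    (∀ i → lookup (S H) i ≡ true → ∃[ a ] (f a ≡ i)) ×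
    (∀ a → lookup (S H) (f a) ≡ true) ×
    (∀ a b → adj F a b ≡ lookup (lookup (E H) (f a)) (f b))

  embeds? : ∀ H f → Dec (Embeds H f)
  embeds? H f =
    (all? λ a → all? λ b → (f a Fin.≟ f b) →-dec (a Fin.≟ b)) ×-dec
    (all? λ i → (_ Bool.≟ true) →-dec any? λ a → f a Fin.≟ i) ×-dec
    (all? λ a → _ Bool.≟ true) ×-dec
    (all? λ a → all? λ b → _ Bool.≟ _)

  embeds-cong : ∀ H {f g} → (∀ a → f a ≡ g a) → Embeds H f → Embeds H g
  embeds-cong H f≗g (inj , surj , into , edges) =
    (λ a b e → inj a b (trans (f≗g a) (trans e (≡.sym (f≗g b))))) ,
    (λ i p → let (a , e) = surj i p in a , trans (≡.sym (f≗g a)) e) ,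
    (λ a → subst (λ i → lookup (S H) i ≡ true) (f≗g a) (into a)) ,
    (λ a b → trans (edges a b) (cong₂ (λ i j → lookup (lookup (E H) i) j) (f≗g a) (f≗g b)))

  -- The isomorphism stored in a copy is irrelevant; finite search recovers one.
  findIso : ∀ H → .(IsoToSub F G H) → IsoToSub F G H
  findIso H iso =
    let (c , e) = recompute (any? λ c → embeds? H (finToFun c)) (search iso) in finToFun c , e
    where
    search : IsoToSub F G H → ∃[ c ] Embeds H (finToFun c)
    search (f , e) = funToFin f , embeds-cong H (≡.sym ∘ finToFun-funToFin f) e

  record Embedding (H : Subgraph G) : Set where
    field
      at        : Fin (n F) → V
      injective : ∀ {a b} → at a ≡ at b → a ≡ b
      onto      : ∀ {v} → mem H v ≡ true → ∃[ a ] (at a ≡ v)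
      edges     : ∀ a b → adj F a b ≡ edge H (at a) (at b)

  -- abstract because the search is expensive to unfold.
  abstract
    embedding : ∀ {v} (P : Copy v) → Embedding (host P)
    embedding (copy H iso _) = let (f , inj , surj , into , edg) = findIso H iso in record
      { at        = dec ∘ f
      ; injective = λ e → inj _ _ (dec-injective e)
      ; onto      = λ p → let (a , e) = surj _ p in a , trans (cong dec e) (dec-enc _)
      ; edges     = λ a b → trans (edg a b)
          (≡.sym (cong₂ (λ i j → lookup (lookup (E H) i) j) (enc-dec (f a)) (enc-dec (f b))))
      }

    embedding-into : ∀ {v} (P : Copy v) a → mem (host P) (Embedding.at (embedding P) a) ≡ true
    embedding-into (copy H iso _) a = let (f , _ , _ , into , _) = findIso H iso in
      subst (λ i → lookup (S H) i ≡ true) (≡.sym (enc-dec (f a))) (into a)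

  -- This allows copies to be bounded from above by lists of vertices, one for each vertex of F.
  host-determined : ∀ {u v} (P : Copy u) (Q : Copy v) →
    (∀ a → Embedding.at (embedding P) a ≡ Embedding.at (embedding Q) a) → host P ≡ host Q
  host-determined P Q at≡ = subgraph-ext
    (λ v → bool-ext (mem⊆ P Q at≡ v) (mem⊆ Q P (≡.sym ∘ at≡) v))
    (λ u v → bool-ext (edge⊆ P Q at≡ u v) (edge⊆ Q P (≡.sym ∘ at≡) u v))
    where
    mem⊆ : ∀ {u v} (P : Copy u) (Q : Copy v) →
      (∀ a → Embedding.at (embedding P) a ≡ Embedding.at (embedding Q) a) →
      ∀ w → mem (host P) w ≡ true → mem (host Q) w ≡ true
    mem⊆ P Q at≡ w p with Embedding.onto (embedding P) p
    ... | a , refl = subst (λ x → mem (host Q) x ≡ true) (≡.sym (at≡ a)) (embedding-into Q a)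

    edge⊆ : ∀ {u v} (P : Copy u) (Q : Copy v) →
      (∀ a → Embedding.at (embedding P) a ≡ Embedding.at (embedding Q) a) →
      ∀ x y → edge (host P) x y ≡ true → edge (host Q) x y ≡ true
    edge⊆ P Q at≡ x y p
      with Embedding.onto (embedding P) (edge⇒memˡ (host P) p)
         | Embedding.onto (embedding P) (edge⇒memʳ (host P) p)
    ... | a , refl | b , refl =
      trans (cong₂ (edge (host Q)) (at≡ a) (at≡ b))
        (trans (≡.sym (Embedding.edges (embedding Q) a b))
          (trans (Embedding.edges (embedding P) a b) p))

  -- Moving copies along permutations of the vertices

  module _ (π : V ↔ V) where
    open Inverse π using (to; from; strictlyInverseˡ; strictlyInverseʳ)

    -- The permutation need not be an automorphism of the graph; only the edges used by H must go to
    -- edges. The swaps and rotations to come are in general no automorphisms.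
    PreservesEdges : Subgraph G → Set
    PreservesEdges H = ∀ u v → edge H u v ≡ true → (to u ~ to v) ≡ true

    relabelS : Subgraph G → Vec Bool N
    relabelS H = tabulate λ i → mem H (from (dec i))

    relabelE : Subgraph G → Vec (Vec Bool N) N
    relabelE H = tabulate λ i → tabulate λ j → edge H (from (dec i)) (from (dec j))

    lookup-relabelE : ∀ H i j →
      lookup (lookup (relabelE H) i) j ≡ edge H (from (dec i)) (from (dec j))
    lookup-relabelE H i j = trans
      (cong (λ row → lookup row j) (lookup∘tabulate (λ i → tabulate λ j → edge H (from (dec i)) (from (dec j))) i))
      (lookup∘tabulate (λ j → edge H (from (dec i)) (from (dec j))) j)

    lookup-relabelS : ∀ H i → lookup (relabelS H) i ≡ mem H (from (dec i))
    lookup-relabelS H = lookup∘tabulate (λ i → mem H (from (dec i)))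

    relabel : ∀ H → .(PreservesEdges H) → Subgraph G
    relabel H ok = sub (relabelS H) (relabelE H)
      (λ i j → trans (lookup-relabelE H i j)
        (trans (bool-ext (edge-sym H) (edge-sym H)) (≡.sym (lookup-relabelE H j i))))
      (λ i j p → ≡.subst₂ (λ u v → (u ~ v) ≡ true) (strictlyInverseˡ (dec i)) (strictlyInverseˡ (dec j))
        (ok _ _ (trans (≡.sym (lookup-relabelE H i j)) p)))
      (λ i j p → trans (lookup-relabelS H i)
        (edge⇒memˡ H (trans (≡.sym (lookup-relabelE H i j)) p)))

    mem-relabel : ∀ H .(ok : PreservesEdges H) v → mem (relabel H ok) v ≡ mem H (from v)
    mem-relabel H ok v = trans (lookup-relabelS H (enc v)) (cong (mem H ∘ from) (dec-enc v))

    edge-relabel : ∀ H .(ok : PreservesEdges H) u v →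
      edge (relabel H ok) u v ≡ edge H (from u) (from v)
    edge-relabel H ok u v = trans (lookup-relabelE H (enc u) (enc v))
      (cong₂ (λ x y → edge H (from x) (from y)) (dec-enc u) (dec-enc v))

    relabel-injective : ∀ {H H′} .{ok : PreservesEdges H} .{ok′ : PreservesEdges H′} →
      relabel H ok ≡ relabel H′ ok′ → H ≡ H′
    relabel-injective {H} {H′} {ok} {ok′} e = subgraph-ext
      (λ v → begin
        mem H v                        ≡⟨ cong (mem H) (strictlyInverseʳ v) ⟨
        mem H (from (to v))            ≡⟨ mem-relabel H ok (to v) ⟨
        mem (relabel H ok) (to v)      ≡⟨ cong (λ K → mem K (to v)) e ⟩
        mem (relabel H′ ok′) (to v)    ≡⟨ mem-relabel H′ ok′ (to v) ⟩
        mem H′ (from (to v))           ≡⟨ cong (mem H′) (strictlyInverseʳ v) ⟩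
        mem H′ v                       ∎)
      (λ u v → begin
        edge H u v                              ≡⟨ cong₂ (edge H) (strictlyInverseʳ u) (strictlyInverseʳ v) ⟨
        edge H (from (to u)) (from (to v))      ≡⟨ edge-relabel H ok (to u) (to v) ⟨
        edge (relabel H ok) (to u) (to v)       ≡⟨ cong (λ K → edge K (to u) (to v)) e ⟩
        edge (relabel H′ ok′) (to u) (to v)     ≡⟨ edge-relabel H′ ok′ (to u) (to v) ⟩
        edge H′ (from (to u)) (from (to v))     ≡⟨ cong₂ (edge H′) (strictlyInverseʳ u) (strictlyInverseʳ v) ⟩
        edge H′ u v                             ∎)
      where open ≡.≡-Reasoning

    relabel-iso : ∀ H .(ok : PreservesEdges H) → IsoToSub F G H → IsoToSub F G (relabel H ok)
    relabel-iso H ok (f , inj , surj , into , edg) =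
      enc ∘ g ,
      (λ a b e → inj a b (dec-injective (g-inj (enc-injective e)))) ,
      (λ i p → let (a , e) = surj _ (trans (≡.sym (lookup-relabelS H i)) p) in
        a , trans (cong (enc ∘ to) (trans (cong dec e) (dec-enc _)))
              (trans (cong enc (strictlyInverseˡ (dec i))) (enc-dec i))) ,
      (λ a → trans (mem-relabel H ok (g a)) (trans (cong (lookup (S H)) (back a)) (into a))) ,
      (λ a b → trans (edg a b) (≡.sym (trans (edge-relabel H ok (g a) (g b))
        (cong₂ (λ i j → lookup (lookup (E H) i) j) (back a) (back b)))))
      where
      g : Fin (n F) → V
      g = to ∘ dec ∘ f

      g-inj : ∀ {u v} → to u ≡ to v → u ≡ v
      g-inj {u} {v} e = trans (≡.sym (strictlyInverseʳ u)) (trans (cong from e) (strictlyInverseʳ v))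

      back : ∀ a → enc (from (g a)) ≡ f a
      back a = trans (cong enc (strictlyInverseʳ (dec (f a)))) (enc-dec (f a))

    relabelCopy : ∀ {u v} (P : Copy u) → .(PreservesEdges (host P)) → .(from v ≡ u) → Copy v
    relabelCopy {u} {v} (copy H iso m) ok e =
      copy (relabel H ok) (relabel-iso H ok iso)
        (trans (mem-relabel H ok v) (trans (cong (mem H) e) m))

  -- An injective homomorphism. Vertices that are not adjacent in F may land on adjacent ones, since
  -- copies need not be induced.
  record Placement : Set where
    field
      at        : Fin (n F) → V
      injective : ∀ {a b} → at a ≡ at b → a ≡ b
      edges     : ∀ {a b} → adj F a b ≡ true → (at a ~ at b) ≡ true

  module _ (f : Placement) where
    open Placement f

    OnEdge : Fin N → Fin N → Set
    OnEdge i j = ∃[ a ] ∃[ b ] (at a ≡ dec i × at b ≡ dec j × adj F a b ≡ true)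

    onEdge? : ∀ i j → Dec (OnEdge i j)
    onEdge? i j = any? λ a → any? λ b →
      (at a ≟ dec i) ×-dec (at b ≟ dec j) ×-dec (adj F a b Bool.≟ true)

    occupied? : ∀ i → Dec (∃[ a ] at a ≡ dec i)
    occupied? i = any? λ a → at a ≟ dec i

    imageS : Vec Bool N
    imageS = tabulate λ i → does (occupied? i)

    imageE : Vec (Vec Bool N) N
    imageE = tabulate λ i → tabulate λ j → does (onEdge? i j)

    lookup-imageS : ∀ i → lookup imageS i ≡ does (occupied? i)
    lookup-imageS = lookup∘tabulate (λ i → does (occupied? i))

    lookup-imageE : ∀ i j → lookup (lookup imageE i) j ≡ does (onEdge? i j)
    lookup-imageE i j = trans
      (cong (λ row → lookup row j) (lookup∘tabulate (λ i → tabulate λ j → does (onEdge? i j)) i))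
      (lookup∘tabulate (λ j → does (onEdge? i j)) j)

    imageE⇒OnEdge : ∀ i j → lookup (lookup imageE i) j ≡ true → OnEdge i j
    imageE⇒OnEdge i j p = does-true (onEdge? i j) (trans (≡.sym (lookup-imageE i j)) p)

    OnEdge-sym : ∀ {i j} → OnEdge i j → OnEdge j i
    OnEdge-sym (a , b , p , q , e) = b , a , q , p , trans (sym F b a) e

    image : Subgraph G
    image = sub imageS imageE
      (λ i j → trans (lookup-imageE i j)
        (trans (bool-ext
          (λ p → dec-true (onEdge? j i) (OnEdge-sym (does-true (onEdge? i j) p)))
          (λ p → dec-true (onEdge? i j) (OnEdge-sym (does-true (onEdge? j i) p))))
        (≡.sym (lookup-imageE j i))))
      (λ i j p → let (a , b , p , q , e) = imageE⇒OnEdge i j p in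
        ≡.subst₂ (λ u v → (u ~ v) ≡ true) p q (edges e))
      (λ i j p → let (a , b , p , q , e) = imageE⇒OnEdge i j p in
        trans (lookup-imageS i) (dec-true (occupied? i) (a , p)))

    image-mem : ∀ a → mem image (at a) ≡ true
    image-mem a = trans (lookup-imageS (enc (at a)))
      (dec-true (occupied? (enc (at a))) (a , ≡.sym (dec-enc (at a))))

    image-onto : ∀ {v} → mem image v ≡ true → ∃[ a ] at a ≡ v
    image-onto {v} p =
      let (a , e) = does-true (occupied? (enc v)) (trans (≡.sym (lookup-imageS (enc v))) p)
      in a , trans e (dec-enc v)

    image-avoids : ∀ {v} → (∀ a → at a ≢ v) → mem image v ≡ false
    image-avoids avoids = bool-ext (λ p → contradiction (image-onto p .proj₂) (avoids _)) (λ ())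

    image-edge : ∀ {a b} → adj F a b ≡ true → edge image (at a) (at b) ≡ true
    image-edge {a} {b} e = trans (lookup-imageE (enc (at a)) (enc (at b)))
      (dec-true (onEdge? (enc (at a)) (enc (at b)))
        (a , b , ≡.sym (dec-enc (at a)) , ≡.sym (dec-enc (at b)) , e))

    image-edge⁻ : ∀ {a b} → edge image (at a) (at b) ≡ true → adj F a b ≡ true
    image-edge⁻ p with imageE⇒OnEdge _ _ p
    ... | a , b , p , q , e =
      ≡.subst₂ (λ a b → adj F a b ≡ true) (injective (trans p (dec-enc _))) (injective (trans q (dec-enc _))) e

    image-iso : IsoToSub F G image
    image-iso =
      enc ∘ at ,
      (λ a b e → injective (enc-injective e)) ,
      (λ i p → let (a , e) = does-true (occupied? i) (trans (≡.sym (lookup-imageS i)) p) in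
        a , trans (cong enc e) (enc-dec i)) ,
      image-mem ,
      (λ a b → bool-ext image-edge image-edge⁻)

    imageCopy : ∀ {v} → .(∃[ a ] at a ≡ v) → Copy v
    imageCopy at≡v = copy image image-iso (hit at≡v)
      where
      hit : ∀ {v} → ∃[ a ] at a ≡ v → mem image v ≡ true
      hit (a , refl) = image-mem a

  ∉⇒≢ : ∀ H {u v} → mem H u ≡ true → mem H v ≡ false → u ≢ v
  ∉⇒≢ H u∈H v∉H refl = true≢false u∈H v∉H

  -- Replacing a vertex of a copy by another

  module Shift (x y : V) where

    Shiftable : Subgraph G → Set
    Shiftable H = ∀ z → edge H x z ≡ true → mem H y ≡ false → (y ~ z) ≡ true

    swap-preserves : ∀ {H} → mem H x ≡ true → mem H y ≡ false → Shiftable H →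
      PreservesEdges (swap↔ _≟_ x y) H
    swap-preserves {H} x∈H y∉H ok u v uv with u ≟ x | v ≟ x
    ... | yes refl | yes refl = contradiction (edge⇒~ H uv) (λ p → true≢false p (~-irrefl u))
    ... | yes refl | no v≢x = trans
      (cong₂ _~_ (swap-left _≟_ x y) (swap-other _≟_ x y v≢x (∉⇒≢ H (edge⇒memʳ H uv) y∉H)))
      (ok v uv y∉H)
    ... | no u≢x | yes refl = trans
      (cong₂ _~_ (swap-other _≟_ x y u≢x (∉⇒≢ H (edge⇒memˡ H uv) y∉H)) (swap-left _≟_ x y))
      (trans (~-sym u y) (ok u (edge-sym H uv) y∉H))
    ... | no u≢x | no v≢x = trans
      (cong₂ _~_ (swap-other _≟_ x y u≢x (∉⇒≢ H (edge⇒memˡ H uv) y∉H))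
                 (swap-other _≟_ x y v≢x (∉⇒≢ H (edge⇒memʳ H uv) y∉H)))
      (edge⇒~ H uv)

    exchange : (P : Copy x) → .(Shiftable (host P)) → .(mem (host P) y ≡ false) → Copy y
    exchange P ok y∉P = relabelCopy (swap↔ _≟_ x y) P
      (swap-preserves {host P} (memb P) y∉P ok) (swap-right _≟_ x y)

    mem-exchange : ∀ P .ok .y∉P v → mem (host (exchange P ok y∉P)) v ≡ mem (host P) (swap _≟_ x y v)
    mem-exchange P@(copy _ _ _) ok y∉P =
      mem-relabel (swap↔ _≟_ x y) (host P) (swap-preserves {host P} (memb P) y∉P ok)

    edge-exchange : ∀ P .ok .y∉P u v →
      edge (host (exchange P ok y∉P)) u v ≡ edge (host P) (swap _≟_ x y u) (swap _≟_ x y v)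
    edge-exchange P@(copy _ _ _) ok y∉P =
      edge-relabel (swap↔ _≟_ x y) (host P) (swap-preserves {host P} (memb P) y∉P ok)

    shift′ : (P : Copy x) → .(Shiftable (host P)) → ∀ b → .(mem (host P) y ≡ b) → Copy y
    shift′ (copy H iso _) ok true  y∈P = copy H iso y∈P
    shift′ P              ok false y∉P = exchange P ok y∉P

    shift : (P : Copy x) → .(Shiftable (host P)) → Copy y
    shift P ok = shift′ P ok (mem (host P) y) refl

    exchange-misses : ∀ P .ok .(y∉P : mem (host P) y ≡ false) → mem (host (exchange P ok y∉P)) x ≡ false
    exchange-misses P ok y∉P = trans (mem-exchange P ok y∉P x)
      (trans (cong (mem (host P)) (swap-left _≟_ x y)) (recompute (_ Bool.≟ false) y∉P))

    -- The vertex x lies in the result exactly when the copy was left as it was, so the two cases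
    -- cannot collide.
    shift′-injective : ∀ P Q .ok .ok′ b b′ .p .q → shift′ P ok b p ≡ shift′ Q ok′ b′ q → P ≡ Q
    shift′-injective (copy _ _ _) (copy _ _ _) ok ok′ true true p q refl = refl
    shift′-injective P@(copy _ _ _) Q ok ok′ true false p q e = contradiction
      (trans (≡.sym (cong (λ K → mem (host K) x) e)) (memb P))
      (λ x∈ → true≢false x∈ (exchange-misses Q ok′ q))
    shift′-injective P Q@(copy _ _ _) ok ok′ false true p q e = contradiction
      (trans (cong (λ K → mem (host K) x) e) (memb Q))
      (λ x∈ → true≢false x∈ (exchange-misses P ok p))
    shift′-injective P@(copy _ _ _) Q@(copy _ _ _) ok ok′ false false p q e =
      copy-ext (relabel-injective (swap↔ _≟_ x y)
        {ok = swap-preserves {host P} (memb P) p ok} {ok′ = swap-preserves {host Q} (memb Q) q ok′}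
        (cong host e))

    shift-injective : ∀ P Q .ok .ok′ → shift P ok ≡ shift Q ok′ → P ≡ Q
    shift-injective P Q ok ok′ = shift′-injective P Q ok ok′ _ _ refl refl

    mem-shift′ : ∀ P .ok b .p {z} → z ≢ x → mem (host P) z ≡ true → mem (host (shift′ P ok b p)) z ≡ true
    mem-shift′ P@(copy _ _ _) ok true  p z≢x z∈P = z∈P
    mem-shift′ P ok false p z≢x z∈P = trans (mem-exchange P ok p _)
      (trans (cong (mem (host P)) (swap-other _≟_ x y z≢x
        (∉⇒≢ (host P) z∈P (recompute (_ Bool.≟ false) p)))) z∈P)

    mem-shift : ∀ P .ok {z} → z ≢ x → mem (host P) z ≡ true → mem (host (shift P ok)) z ≡ true
    mem-shift P ok = mem-shift′ P ok _ refl

    -- Shifting a copy creates no edge from y to a non-neighbour of x, unless x stays in the copy.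
    Unshifted : Subgraph G → V → Set
    Unshifted H z = mem H x ≡ false × edge H y z ≡ true × (x ~ z) ≡ false

    shift′-unshifted : ∀ P .ok b .p {z} → ¬ Unshifted (host (shift′ P ok b p)) z
    shift′-unshifted P@(copy _ _ _) ok true p (x∉ , _ , _) = true≢false (memb P) x∉
    shift′-unshifted P ok false p {z} (x∉ , yz , x≁z) =
      true≢false (edge⇒~ (host P) (trans (≡.sym edge≡) yz)) x≁z
      where
      K : Subgraph G
      K = host (exchange P ok p)

      z≢y : z ≢ y
      z≢y refl = true≢false (edge⇒~ K yz) (~-irrefl y)

      edge≡ : edge K y z ≡ edge (host P) x z
      edge≡ = trans (edge-exchange P ok p y z) (cong₂ (edge (host P)) (swap-right _≟_ x y)
        (swap-other _≟_ x y (∉⇒≢ K (edge⇒memʳ K yz) x∉) z≢y))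

    shift-unshifted : ∀ P .ok {z} → ¬ Unshifted (host (shift P ok)) z
    shift-unshifted P ok = shift′-unshifted P ok _ refl

  module _ (diam≤2 : ∀ a b → DistLe F a b 2) where

    near : ∀ {x} (P : Copy x) {u v} → mem (host P) u ≡ true → mem (host P) v ≡ true →
      u ≡ v ⊎ edge (host P) u v ≡ true ⊎ ∃[ w ] (edge (host P) u w ≡ true × edge (host P) w v ≡ true)
    near P u∈P v∈P with embedding P
    ... | e with Embedding.onto e u∈P | Embedding.onto e v∈P
    ...   | a , refl | b , refl with diam≤2 a b
    ...     | _ , _ , here = inj₁ refl
    ...     | _ , _ , step ab here = inj₂ (inj₁ (trans (≡.sym (Embedding.edges e a b)) ab))
    ...     | _ , _ , step ac (step cb here) = inj₂ (inj₂ (_ ,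
      trans (≡.sym (Embedding.edges e _ _)) ac , trans (≡.sym (Embedding.edges e _ _)) cb))
    ...     | _ , s≤s (s≤s ()) , step _ (step _ (step _ _))

  infix 4 _≺_
  -- The extra point `nothing` makes the comparison strict without any degree being computed;
  -- numbers enter only through the bijections in `FDegreeIs`.
  _≺_ : V → V → Set
  u ≺ v = Maybe (Copy u) ↣ Copy v

  ≺-trans : ∀ {u v w} → u ≺ v → v ≺ w → u ≺ w
  ≺-trans f g = mk↣ {to = λ x → to g (just (to f x))} λ e → injective f (just-injective (injective g e))
    where open Injection

  ≺⇒< : ∀ {u v k l} → u ≺ v → FDegreeIs F G (enc u) k → FDegreeIs F G (enc v) l → k < l
  ≺⇒< {u} {v} {k} {l} f du dv = injective⇒≤ {f = Inverse.from dv ∘ Injection.to f ∘ index}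
    λ e → index-injective (Injection.injective f (Injection.injective (↔⇒↣ (↔-sym dv)) e))
    where
    index : Fin (suc k) → Maybe (Copy u)
    index zero    = nothing
    index (suc i) = just (Inverse.to du i)

    index-injective : ∀ {i j} → index i ≡ index j → i ≡ j
    index-injective {zero}  {zero}  _ = refl
    index-injective {suc i} {suc j} e = cong suc (Injection.injective (↔⇒↣ du) (just-injective e))

-- The graph

data Vertex (n : ℕ) : Set where
  A B : Fin n → Vertex n
  T D : Vertex n

module _ {n : ℕ} where

  -- Were enc to compute, v could not be recovered from Copy v by unification.
  abstract
    enc : Vertex n → Fin (2 + (n + n))
    enc D     = zero
    enc T     = suc zero
    enc (A i) = suc (suc (i ↑ˡ n))
    enc (B i) = suc (suc (n ↑ʳ i))

    dec-AB : Fin n ⊎ Fin n → Vertex n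
    dec-AB (inj₁ i) = A i
    dec-AB (inj₂ i) = B i

    dec : Fin (2 + (n + n)) → Vertex n
    dec zero          = D
    dec (suc zero)    = T
    dec (suc (suc k)) = dec-AB (splitAt n k)

    dec-enc : ∀ v → dec (enc v) ≡ v
    dec-enc (A i) = cong dec-AB (Fin.splitAt-↑ˡ n i n)
    dec-enc (B i) = cong dec-AB (Fin.splitAt-↑ʳ n n i)
    dec-enc T     = refl
    dec-enc D     = refl

    enc-dec : ∀ k → enc (dec k) ≡ k
    enc-dec zero          = refl
    enc-dec (suc zero)    = refl
    enc-dec (suc (suc k)) with splitAt n k in eq
    ... | inj₁ i = cong (λ l → suc (suc l)) (Fin.splitAt⁻¹-↑ˡ eq)
    ... | inj₂ i = cong (λ l → suc (suc l)) (Fin.splitAt⁻¹-↑ʳ eq)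

  module _ (s : ℕ) where

    -- Between A and B this is a half graph: neighbourhoods are nested, and the rule is symmetric in
    -- the two indices, so that A and B can be interchanged.
    adjacent : Vertex n → Vertex n → Bool
    adjacent (A i) (A j) = not (does (i Fin.≟ j))
    adjacent (A i) (B j) = does (n ℕ.≤? toℕ i + toℕ j)
    adjacent (A i) T     = true
    adjacent (A i) D     = does (toℕ i ℕ.<? s)
    adjacent (B j) (A i) = does (n ℕ.≤? toℕ i + toℕ j)
    adjacent (B i) (B j) = not (does (i Fin.≟ j))
    adjacent (B i) T     = true
    adjacent (B i) D     = false
    adjacent T     (A i) = true
    adjacent T     (B i) = true
    adjacent T     T     = false
    adjacent T     D     = false
    adjacent D     (A i) = does (toℕ i ℕ.<? s)
    adjacent D     (B i) = false
    adjacent D     T     = false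
    adjacent D     D     = false

    ≢⇒not-does : ∀ {i j : Fin n} → i ≢ j → not (does (i Fin.≟ j)) ≡ true
    ≢⇒not-does {i} {j} i≢j = cong not (dec-false (i Fin.≟ j) i≢j)

    not-does-sym : ∀ (i j : Fin n) → not (does (i Fin.≟ j)) ≡ not (does (j Fin.≟ i))
    not-does-sym i j with j Fin.≟ i
    ... | yes j≡i = cong not (dec-true (i Fin.≟ j) (≡.sym j≡i))
    ... | no j≢i  = ≢⇒not-does (j≢i ∘ ≡.sym)

    adjacent-sym : ∀ u v → adjacent u v ≡ adjacent v u
    adjacent-sym (A i) (A j) = not-does-sym i j
    adjacent-sym (A i) (B j) = refl
    adjacent-sym (A i) T     = refl
    adjacent-sym (A i) D     = refl
    adjacent-sym (B i) (A j) = refl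
    adjacent-sym (B i) (B j) = not-does-sym i j
    adjacent-sym (B i) T     = refl
    adjacent-sym (B i) D     = refl
    adjacent-sym T     (A i) = refl
    adjacent-sym T     (B i) = refl
    adjacent-sym T     T     = refl
    adjacent-sym T     D     = refl
    adjacent-sym D     (A i) = refl
    adjacent-sym D     (B i) = refl
    adjacent-sym D     T     = refl
    adjacent-sym D     D     = refl

    adjacent-irrefl : ∀ v → adjacent v v ≡ false
    adjacent-irrefl (A i) = cong not (dec-true (i Fin.≟ i) refl)
    adjacent-irrefl (B i) = cong not (dec-true (i Fin.≟ i) refl)
    adjacent-irrefl T     = refl
    adjacent-irrefl D     = refl

module Construction (F : Graph) (q s : ℕ)
  (0<q : 0 < q) (0<s : 0 < s) (2s≤n : s + s ≤ 2 + n F * q) where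

  m r ℓ : ℕ
  m = n F
  r = m * q
  ℓ = 2 + r

  _~_ : Vertex ℓ → Vertex ℓ → Bool
  _~_ = adjacent s

  code : Vertex ℓ → Fin (2 + (ℓ + ℓ))
  code = enc

  decode : Fin (2 + (ℓ + ℓ)) → Vertex ℓ
  decode = dec

  open Copies F code decode dec-enc enc-dec _~_ (adjacent-sym s) (adjacent-irrefl s) public

  s<ℓ : s < ℓ
  s<ℓ = ℕ.<-≤-trans (ℕ.m<m+n s 0<s) 2s≤n

  m≤ℓ : m ≤ ℓ
  m≤ℓ = ℕ.≤-trans (ℕ.m≤m*n m q {{ℕ.>-nonZero 0<q}}) (ℕ.m≤n+m r 2)

  A~B : ∀ {i j : Fin ℓ} → ℓ ≤ toℕ i + toℕ j → (A i ~ B j) ≡ true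
  A~B {i} {j} = dec-true (ℓ ℕ.≤? toℕ i + toℕ j)

  A~B⁻ : ∀ {i j : Fin ℓ} → (A i ~ B j) ≡ true → ℓ ≤ toℕ i + toℕ j
  A~B⁻ {i} {j} = does-true (ℓ ℕ.≤? toℕ i + toℕ j)

  A≁B : ∀ {i j : Fin ℓ} → toℕ i + toℕ j < ℓ → (A i ~ B j) ≡ false
  A≁B {i} {j} lt = dec-false (ℓ ℕ.≤? toℕ i + toℕ j) (ℕ.<⇒≱ lt)

  D~A : ∀ {i : Fin ℓ} → toℕ i < s → (D ~ A i) ≡ true
  D~A {i} = dec-true (toℕ i ℕ.<? s)

  D~A⁻ : ∀ {i : Fin ℓ} → (D ~ A i) ≡ true → toℕ i < s
  D~A⁻ {i} = does-true (toℕ i ℕ.<? s)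

  A₀≁B : ∀ (j : Fin ℓ) → (A zero ~ B j) ≡ false
  A₀≁B j = A≁B {zero} {j} (Fin.toℕ<n j)



  -- The diameter

  edge→step : ∀ {u v w k} → (u ~ v) ≡ true → Walk G (code v) w k → Walk G (code u) w (suc k)
  edge→step {u} {v} e = step (trans (cong₂ _~_ (dec-enc u) (dec-enc v)) e)

  step→edge : ∀ {u v} → adj G (code u) (code v) ≡ true → (u ~ v) ≡ true
  step→edge {u} {v} e = trans (≡.sym (cong₂ _~_ (dec-enc u) (dec-enc v))) e

  to-T : ∀ u → u ≢ D → DistLe G (code u) (code T) 1
  to-T (A i) _ = 1 , s≤s z≤n , edge→step {A i} {T} refl here
  to-T (B i) _ = 1 , s≤s z≤n , edge→step {B i} {T} refl here
  to-T T     _ = 0 , z≤n , here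
  to-T D     D≢D = contradiction refl D≢D

  from-T : ∀ u → u ≢ D → DistLe G (code T) (code u) 1
  from-T (A i) _ = 1 , s≤s z≤n , edge→step {T} {A i} refl here
  from-T (B i) _ = 1 , s≤s z≤n , edge→step {T} {B i} refl here
  from-T T     _ = 0 , z≤n , here
  from-T D     D≢D = contradiction refl D≢D

  walk-trans : ∀ {u v w k l} → Walk G u v k → Walk G v w l → Walk G u w (k + l)
  walk-trans here       q = q
  walk-trans (step e p) q = step e (walk-trans p q)

  dist-trans : ∀ {u v w k l} → DistLe G u v k → DistLe G v w l → DistLe G u w (k + l)
  dist-trans (_ , j≤k , p) (_ , j′≤l , q) = _ , ℕ.+-mono-≤ j≤k j′≤l , walk-trans p q

  D→T : DistLe G (code D) (code T) 2
  D→T = 2 , ℕ.≤-refl , edge→step {D} {A zero} (D~A {zero} 0<s) (edge→step {A zero} {T} refl here)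

  T→D : DistLe G (code T) (code D) 2
  T→D = 2 , ℕ.≤-refl , edge→step {T} {A zero} refl (edge→step {A zero} {D} (D~A {zero} 0<s) here)

  dist≤3 : ∀ u v → DistLe G (code u) (code v) 3
  dist≤3 u v with u ≟ D | v ≟ D
  ... | yes refl | yes refl = 0 , z≤n , here
  ... | yes refl | no v≢D   = dist-trans D→T (from-T v v≢D)
  ... | no u≢D   | yes refl = dist-trans (to-T u u≢D) T→D
  ... | no u≢D   | no v≢D   =
    let (j , j≤2 , p) = dist-trans (to-T u u≢D) (from-T v v≢D) in j , ℕ.m≤n⇒m≤1+n j≤2 , p

  far : ∀ w → (D ~ w) ≡ true → (w ~ B zero) ≡ false
  far (A i) p = A≁B {i} {zero} (ℕ.<-trans (subst (_< s) (≡.sym (ℕ.+-identityʳ (toℕ i))) (D~A⁻ {i} p)) s<ℓ)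

  walk₀ : ∀ {u v} → Walk G u v 0 → u ≡ v
  walk₀ here = refl

  D-B₀-far : ∀ j → Walk G (code D) (code (B zero)) j → 3 ≤ j
  D-B₀-far 0 p = contradiction (enc-injective {D} {B zero} (walk₀ p)) λ ()
  D-B₀-far 1 (step e p) = contradiction
    (step→edge {D} {B zero} (subst (λ w → adj G (code D) w ≡ true) (walk₀ p) e)) λ ()
  D-B₀-far 2 (step {w = w} e (step e′ p)) = ⊥-elim (true≢false
    (trans (≡.sym (cong (decode w ~_) (dec-enc (B zero)))) (subst (λ v → adj G w v ≡ true) (walk₀ p) e′))
    (far (decode w) (trans (cong (_~ decode w) (≡.sym (dec-enc D))) e)))
  D-B₀-far (suc (suc (suc _))) _ = s≤s (s≤s (s≤s z≤n))

  G-diameter : HasDiameter G 3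
  G-diameter =
    (λ u v → ≡.subst₂ (λ u v → DistLe G u v 3) (enc-dec u) (enc-dec v) (dist≤3 (decode u) (decode v))) ,
    code D , code (B zero) , D-B₀-far

  -- Comparison of degrees

  mirror : Vertex ℓ → Vertex ℓ
  mirror (A i) = B i
  mirror (B i) = A i
  mirror T     = T
  mirror D     = D

  mirror-involutive : ∀ v → mirror (mirror v) ≡ v
  mirror-involutive (A i) = refl
  mirror-involutive (B i) = refl
  mirror-involutive T     = refl
  mirror-involutive D     = refl

  mirror↔ : Vertex ℓ ↔ Vertex ℓ
  mirror↔ = mk↔ₛ′ mirror mirror mirror-involutive mirror-involutive

  mirror-~ : ∀ u v → u ≢ D → v ≢ D → (u ~ v) ≡ true → (mirror u ~ mirror v) ≡ true
  mirror-~ D     v     D≢D _   _ = contradiction refl D≢D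
  mirror-~ u     D     _   D≢D _ = contradiction refl D≢D
  mirror-~ (A i) (A j) _ _ p = p
  mirror-~ (A i) (B j) _ _ p = A~B {j} {i} (subst (ℓ ≤_) (ℕ.+-comm (toℕ i) (toℕ j)) (A~B⁻ {i} {j} p))
  mirror-~ (A i) T     _ _ p = p
  mirror-~ (B i) (A j) _ _ p = A~B {i} {j} (subst (ℓ ≤_) (ℕ.+-comm (toℕ j) (toℕ i)) (A~B⁻ {j} {i} p))
  mirror-~ (B i) (B j) _ _ p = p
  mirror-~ (B i) T     _ _ p = p
  mirror-~ T     (A i) _ _ p = p
  mirror-~ T     (B i) _ _ p = p

  mirror-preserves : ∀ H → mem H D ≡ false → PreservesEdges mirror↔ H
  mirror-preserves H D∉H u v uv = mirror-~ u v
    (∉⇒≢ H (edge⇒memˡ H uv) D∉H) (∉⇒≢ H (edge⇒memʳ H uv) D∉H) (edge⇒~ H uv)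

  mirrorCopy : ∀ {v} (P : Copy (mirror v)) → .(mem (host P) D ≡ false) → Copy v
  mirrorCopy P D∉P = relabelCopy mirror↔ P (mirror-preserves (host P) D∉P) refl

  mirrorCopy-D : ∀ {v} (P : Copy (mirror v)) .(D∉P : mem (host P) D ≡ false) →
    mem (host (mirrorCopy {v} P D∉P)) D ≡ false
  mirrorCopy-D P@(copy _ _ _) D∉P =
    trans (mem-relabel mirror↔ (host P) (mirror-preserves (host P) D∉P) D)
      (recompute (_ Bool.≟ false) D∉P)

  mirrorCopy-injective : ∀ {v} (P Q : Copy (mirror v)) .p .q →
    mirrorCopy {v} P p ≡ mirrorCopy {v} Q q → P ≡ Q
  mirrorCopy-injective P@(copy _ _ _) Q@(copy _ _ _) p q e = copy-ext
    (relabel-injective mirror↔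
      {ok = mirror-preserves (host P) p} {ok′ = mirror-preserves (host Q) q} (cong host e))

  module _ (diam≤2 : ∀ a b → DistLe F a b 2) where

    -- D has no neighbour in B, so the diameter bound provides a common neighbour of D and `B j`,
    -- and D is adjacent to nothing but the first s vertices of A.
    reach : ∀ {u} (P : Copy u) {j} → mem (host P) D ≡ true → mem (host P) (B j) ≡ true →
      ∃[ l ] (l < s × ℓ ≤ l + toℕ j)
    reach P {j} D∈P B∈P with near diam≤2 P D∈P B∈P
    ... | inj₁ ()
    ... | inj₂ (inj₁ DB) = contradiction (edge⇒~ (host P) {D} {B j} DB) λ ()
    ... | inj₂ (inj₂ (A l , DA , AB)) = toℕ l , D~A⁻ {l} (edge⇒~ (host P) {D} {A l} DA) ,
      A~B⁻ {l} {j} (edge⇒~ (host P) {A l} {B j} AB)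
    ... | inj₂ (inj₂ (B l , DB , _)) = contradiction (edge⇒~ (host P) {D} {B l} DB) λ ()
    ... | inj₂ (inj₂ (T , DT , _)) = contradiction (edge⇒~ (host P) {D} {T} DT) λ ()
    ... | inj₂ (inj₂ (D , DD , _)) = contradiction (edge⇒~ (host P) {D} {D} DD) λ ()

    -- Both i and j exceed ℓ - s, and `2s≤n` is the bound that brings their sum to at least ℓ.
    reach-sum : ∀ {k l i j} → k < s → l < s → ℓ ≤ k + i → ℓ ≤ l + j → ℓ ≤ i + j
    reach-sum {k} {l} {i} {j} k<s l<s ℓ≤k+i ℓ≤l+j = ℕ.+-cancelˡ-≤ ℓ ℓ (i + j) (begin
      ℓ + ℓ              ≤⟨ ℕ.+-mono-≤ ℓ≤k+i ℓ≤l+j ⟩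
      (k + i) + (l + j)  ≡⟨ interchange k i l j ⟩
      (k + l) + (i + j)  ≤⟨ ℕ.+-monoˡ-≤ (i + j) (ℕ.+-mono-≤ (ℕ.<⇒≤ k<s) (ℕ.<⇒≤ l<s)) ⟩
      (s + s) + (i + j)  ≤⟨ ℕ.+-monoˡ-≤ (i + j) 2s≤n ⟩
      ℓ + (i + j)        ∎)
      where open ℕ.≤-Reasoning

    -- Among the neighbours of `B i`, those that `A i` might lack are the `B j`. In a copy with D,
    -- both indices are so large that `A i` is adjacent to `B j`.
    BA-shiftable : ∀ i {u} (P : Copy u) → mem (host P) D ≡ true → Shift.Shiftable (B i) (A i) (host P)
    BA-shiftable i P D∈P (A j) e A∉P = ≢⇒not-does s {i} {j} λ { refl → true≢false (edge⇒memʳ (host P) e) A∉P }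
    BA-shiftable i P D∈P (B j) e A∉P =
      let (k , k<s , ℓ≤k+i) = reach P {i} D∈P (edge⇒memˡ (host P) e)
          (l , l<s , ℓ≤l+j) = reach P {j} D∈P (edge⇒memʳ (host P) e)
      in A~B {i} {j} (reach-sum k<s l<s ℓ≤k+i ℓ≤l+j)
    BA-shiftable i P D∈P T e A∉P = refl
    BA-shiftable i P D∈P D e A∉P = contradiction (edge⇒~ (host P) {B i} {D} e) λ ()

    -- Copies through D are shifted from B i to A i, all others are mirrored.
    B≺A : ∀ i (Q : Copy (A i)) → mem (host Q) D ≡ true →
      ∃[ z ] Shift.Unshifted (B i) (A i) (host Q) z → B i ≺ A i
    B≺A i Q D∈Q (z , unshifted) = glue through f g f-inj g-inj f≢g
      where
      open Shift (B i) (A i)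

      through : Maybe (Copy (B i)) → Bool
      through nothing  = true
      through (just P) = mem (host P) D

      f : ∀ x → through x ≡ true → Copy (A i)
      f nothing  _   = Q
      f (just P) D∈P = shift P (BA-shiftable i P D∈P)

      g : ∀ x → through x ≡ false → Copy (A i)
      g (just P) D∉P = mirrorCopy P D∉P

      f-D : ∀ x p → mem (host (f x p)) D ≡ true
      f-D nothing  _   = D∈Q
      f-D (just P) D∈P = mem-shift P (BA-shiftable i P D∈P) {D} (λ ()) D∈P

      f-inj : ∀ x x′ p p′ → f x p ≡ f x′ p′ → x ≡ x′
      f-inj nothing  nothing  _ _ _ = refl
      f-inj nothing  (just P) _ p e =
        contradiction (subst (λ K → Unshifted (host K) z) e unshifted)
          (shift-unshifted P (BA-shiftable i P p) {z})
      f-inj (just P) nothing  p _ e =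
        contradiction (subst (λ K → Unshifted (host K) z) (≡.sym e) unshifted)
          (shift-unshifted P (BA-shiftable i P p) {z})
      f-inj (just P) (just P′) p p′ e =
        cong just (shift-injective P P′ (BA-shiftable i P p) (BA-shiftable i P′ p′) e)

      g-inj : ∀ x x′ p p′ → g x p ≡ g x′ p′ → x ≡ x′
      g-inj (just P) (just P′) p p′ e = cong just (mirrorCopy-injective P P′ p p′ e)

      f≢g : ∀ x x′ p p′ → f x p ≢ g x′ p′
      f≢g x (just P′) p p′ e = true≢false (f-D x p)
        (trans (cong (λ K → mem (host K) D) e) (mirrorCopy-D P′ p′))

  module Step (p : Fin (suc r)) where
    open Shift (B (inject₁ p)) (B (suc p)) public

    -- The one vertex of A that is adjacent to `B (suc p)` but not to `B (inject₁ p)`: the indices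
    -- add up to ℓ in the first case and to ℓ - 1 in the second.
    apex : Vertex ℓ
    apex = A (opposite (inject₁ p))

    BB-shiftable : ∀ H → Shiftable H
    BB-shiftable H (A j) e B∉H = A~B {j} {suc p} (ℕ.≤-trans
      (A~B⁻ {j} {inject₁ p} (edge⇒~ H {B (inject₁ p)} {A j} e))
      (ℕ.+-monoʳ-≤ (toℕ j) (ℕ.≤-trans (ℕ.≤-reflexive (Fin.toℕ-inject₁ p)) (ℕ.n≤1+n (toℕ p)))))
    BB-shiftable H (B j) e B∉H = ≢⇒not-does s {suc p} {j} λ { refl → true≢false (edge⇒memʳ H e) B∉H }
    BB-shiftable H T e B∉H = refl
    BB-shiftable H D e B∉H = contradiction (edge⇒~ H {B (inject₁ p)} {D} e) λ ()

    B≁apex : (B (inject₁ p) ~ apex) ≡ false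
    B≁apex = A≁B {opposite (inject₁ p)} {inject₁ p}
      (ℕ.≤-reflexive (cong suc (opposite-sum (inject₁ p))))

    -- The copies to be compensated contain both D and `A (inject₁ p)`. Bounding them by all copies
    -- through D lets a single count serve every p.
    record Gain : Set where
      field
        to        : Maybe (Copy D) → Copy (B (suc p))
        injective : ∀ {x y} → to x ≡ to y → x ≡ y
        unshifted : ∀ x → Unshifted (host (to x)) apex

    -- Mirrored and shifted, a copy avoiding D never becomes one counted by Gain.
    A≺B : Gain → A (inject₁ p) ≺ B (suc p)
    A≺B gain = glue through f g f-inj g-inj f≢g
      where
      open Gain gain

      through : Maybe (Copy (A (inject₁ p))) → Bool
      through nothing  = true
      through (just P) = mem (host P) D

      atD : ∀ x → .(through x ≡ true) → Maybe (Copy D)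
      atD nothing             _   = nothing
      atD (just (copy H iso _)) D∈P = just (copy H iso D∈P)

      atD-injective : ∀ x x′ .p .p′ → atD x p ≡ atD x′ p′ → x ≡ x′
      atD-injective nothing  nothing  _ _ _ = refl
      atD-injective (just (copy _ _ _)) (just (copy _ _ _)) _ _ refl = refl

      f : ∀ x → through x ≡ true → Copy (B (suc p))
      f x t = to (atD x t)

      g : ∀ x → through x ≡ false → Copy (B (suc p))
      g (just P) D∉P = shift (mirrorCopy P D∉P) (BB-shiftable (host (mirrorCopy P D∉P)))

      f-inj : ∀ x x′ p p′ → f x p ≡ f x′ p′ → x ≡ x′
      f-inj x x′ p p′ e = atD-injective x x′ p p′ (injective e)

      g-inj : ∀ x x′ p p′ → g x p ≡ g x′ p′ → x ≡ x′
      g-inj (just P) (just P′) p p′ e = cong just (mirrorCopy-injective P P′ p p′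
        (shift-injective (mirrorCopy P p) (mirrorCopy P′ p′)
          (BB-shiftable (host (mirrorCopy P p))) (BB-shiftable (host (mirrorCopy P′ p′))) e))

      f≢g : ∀ x x′ p p′ → f x p ≢ g x′ p′
      f≢g x (just P′) p p′ e = shift-unshifted (mirrorCopy P′ p′) (BB-shiftable (host (mirrorCopy P′ p′)))
        (subst (λ K → Unshifted (host K) apex) e (unshifted (atD x p)))

  last : Fin ℓ
  last = fromℕ (suc r)

  -- Since s < ℓ, the vertex `A last` is not adjacent to D, so T has all its neighbours other than T
  -- itself. The neighbour `B zero` of T is the one to exploit: its index and that of `A last` add
  -- up to ℓ - 1 only.
  A≺T : (Q : Copy T) → Shift.Unshifted (A last) T (host Q) (B zero) → A last ≺ T
  A≺T Q unshifted = adjoin Q (λ P → shift P (ok P))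
    (λ P P′ → shift-injective P P′ (ok P) (ok P′))
    λ P e → shift-unshifted P (ok P) {B zero}
      (subst (λ K → Unshifted (host K) (B zero)) (≡.sym e) unshifted)
    where
    open Shift (A last) T

    A-last≁D : (A last ~ D) ≡ false
    A-last≁D = dec-false (toℕ last ℕ.<? s)
      (ℕ.≤⇒≯ (subst (s ≤_) (≡.sym (Fin.toℕ-fromℕ (suc r))) (ℕ.s≤s⁻¹ s<ℓ)))

    ok : ∀ {u} (P : Copy u) → Shiftable (host P)
    ok P (A i) _ _   = refl
    ok P (B i) _ _   = refl
    ok P T     e T∉P = ⊥-elim (true≢false (edge⇒memʳ (host P) e) T∉P)
    ok P D     e _   = ⊥-elim (true≢false (edge⇒~ (host P) {A last} {D} e) A-last≁D)

  -- Assembling the linear order of the degrees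

  irregular : D ≺ B zero → (∀ i → B i ≺ A i) → (∀ p → A (inject₁ p) ≺ B (suc p)) → A last ≺ T →
    FIrregular F G
  irregular D≺B₀ B≺A A≺B A≺T u w k l du dw u≢w k≡l =
    [ (λ lt → ℕ.<⇒≢ (≺⇒< {decode u} {decode w} lt du′ dw′) k≡l)
    , (λ gt → ℕ.<⇒≢ (≺⇒< {decode w} {decode u} gt dw′ du′) (≡.sym k≡l))
    ]′ (compare (decode u) (decode w) (u≢w ∘ dec-injective))
    where
    du′ : FDegreeIs F G (code (decode u)) k
    du′ = subst (λ v → FDegreeIs F G v k) (≡.sym (enc-dec u)) du

    dw′ : FDegreeIs F G (code (decode w)) l
    dw′ = subst (λ v → FDegreeIs F G v l) (≡.sym (enc-dec w)) dw

    ≺ᵗ : ∀ {u} v {w} → u ≺ v → v ≺ w → u ≺ w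
    ≺ᵗ {u} v {w} = ≺-trans {u} {v} {w}

    A≺B′ : ∀ {i j} → toℕ j ≡ suc (toℕ i) → A i ≺ B j
    A≺B′ {i} {suc j} e = subst (λ i → A i ≺ B (suc j))
      (Fin.toℕ-injective (trans (Fin.toℕ-inject₁ j) (ℕ.suc-injective e))) (A≺B j)

    A≺B< : ∀ {i j} → toℕ i < toℕ j → A i ≺ B j
    -- The relation `A i ≺ B j` is transitive because `B j ≺ A j` joins two instances of it.
    A≺B< = chain (λ i j → A i ≺ B j)
      (λ {i} {j} {k} x y → ≺ᵗ {A i} (B j) {B k} x (≺ᵗ {B j} (A j) {B k} (B≺A j) y)) A≺B′

    A≺A< : ∀ {i j} → toℕ i < toℕ j → A i ≺ A j
    A≺A< {i} {j} lt = ≺ᵗ {A i} (B j) {A j} (A≺B< lt) (B≺A j)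

    B≺B< : ∀ {i j} → toℕ i < toℕ j → B i ≺ B j
    B≺B< {i} {j} lt = ≺ᵗ {B i} (A i) {B j} (B≺A i) (A≺B< lt)

    B≺A< : ∀ {i j} → toℕ i < toℕ j → B i ≺ A j
    B≺A< {i} {j} lt = ≺ᵗ {B i} (A i) {A j} (B≺A i) (A≺A< lt)

    D≺B : ∀ j → D ≺ B j
    D≺B zero    = D≺B₀
    D≺B (suc j) = ≺ᵗ {D} (B zero) {B (suc j)} D≺B₀ (B≺B< (s≤s z≤n))

    D≺A : ∀ j → D ≺ A j
    D≺A j = ≺ᵗ {D} (B j) {A j} (D≺B j) (B≺A j)

    A≺T′ : ∀ i → A i ≺ T
    A≺T′ i with Fin.<-cmp i last
    ... | tri< i<last _ _ = ≺ᵗ {A i} (A last) {T} (A≺A< i<last) A≺T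
    ... | tri≈ _ refl _   = A≺T
    ... | tri> _ _ i>last = contradiction (Fin.≤fromℕ i) (ℕ.<⇒≱ i>last)

    B≺T : ∀ i → B i ≺ T
    B≺T i = ≺ᵗ {B i} (A i) {T} (B≺A i) (A≺T′ i)

    D≺T : D ≺ T
    D≺T = ≺ᵗ {D} (A zero) {T} (D≺A zero) (A≺T′ zero)

    compare : ∀ u w → u ≢ w → u ≺ w ⊎ w ≺ u
    compare (A i) (A j) u≢w with Fin.<-cmp i j
    ... | tri< i<j _ _ = inj₁ (A≺A< i<j)
    ... | tri≈ _ refl _ = contradiction refl u≢w
    ... | tri> _ _ j<i = inj₂ (A≺A< j<i)
    compare (A i) (B j) _ with Fin.<-cmp i j
    ... | tri< i<j _ _ = inj₁ (A≺B< i<j)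
    ... | tri≈ _ refl _ = inj₂ (B≺A i)
    ... | tri> _ _ j<i = inj₂ (B≺A< j<i)
    compare (A i) T _ = inj₁ (A≺T′ i)
    compare (A i) D _ = inj₂ (D≺A i)
    compare (B i) (A j) _ with Fin.<-cmp i j
    ... | tri< i<j _ _ = inj₁ (B≺A< i<j)
    ... | tri≈ _ refl _ = inj₁ (B≺A i)
    ... | tri> _ _ j<i = inj₂ (A≺B< j<i)
    compare (B i) (B j) u≢w with Fin.<-cmp i j
    ... | tri< i<j _ _ = inj₁ (B≺B< i<j)
    ... | tri≈ _ refl _ = contradiction refl u≢w
    ... | tri> _ _ j<i = inj₂ (B≺B< j<i)
    compare (B i) T _ = inj₁ (B≺T i)
    compare (B i) D _ = inj₂ (D≺B i)
    compare T (A i) _ = inj₂ (A≺T′ i)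
    compare T (B i) _ = inj₂ (B≺T i)
    compare T T T≢T = contradiction refl T≢T
    compare T D _ = inj₂ D≺T
    compare D (A i) _ = inj₁ (D≺A i)
    compare D (B i) _ = inj₁ (D≺B i)
    compare D T _ = inj₁ D≺T
    compare D D D≢D = contradiction refl D≢D

  -- Copies inside cliques

  clique-injective : (κ : Fin ℓ → Vertex ℓ) → (∀ {i j} → i ≢ j → (κ i ~ κ j) ≡ true) →
    ∀ {i j} → κ i ≡ κ j → i ≡ j
  clique-injective κ κ-clique {i} {j} e with i Fin.≟ j
  ... | yes i≡j = i≡j
  ... | no i≢j  = ⊥-elim (true≢false (κ-clique i≢j)
    (trans (cong (κ i ~_) (≡.sym e)) (adjacent-irrefl s (κ i))))

  cliquePlacement : (κ : Fin ℓ → Vertex ℓ) → (∀ {i j} → i ≢ j → (κ i ~ κ j) ≡ true) →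
    (h : Fin m → Fin ℓ) → (∀ {a b} → h a ≡ h b → a ≡ b) → Placement
  cliquePlacement κ κ-clique h h-inj = record
    { at        = κ ∘ h
    ; injective = λ e → h-inj (clique-injective κ κ-clique e)
    ; edges     = λ ab → κ-clique (adj⇒≢ F ab ∘ h-inj)
    }

  -- The vertices B k with c ≤ k together with their common neighbours among the A.
  stair : ℕ → Fin ℓ → Vertex ℓ
  stair c k with toℕ k ℕ.<? c
  ... | yes _ = A (opposite k)
  ... | no _  = B k

  stair-A : ∀ {c k} → toℕ k < c → stair c k ≡ A (opposite k)
  stair-A {c} {k} k<c with toℕ k ℕ.<? c
  ... | yes _  = refl
  ... | no k≮c = contradiction k<c k≮c

  stair-B : ∀ {c k} → c ≤ toℕ k → stair c k ≡ B k
  stair-B {c} {k} c≤k with toℕ k ℕ.<? c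
  ... | yes k<c = contradiction k<c (ℕ.≤⇒≯ c≤k)
  ... | no _    = refl

  stair≢B : ∀ {c k} a → toℕ k < c → stair c a ≢ B k
  stair≢B {c} {k} a k<c e with toℕ a ℕ.<? c
  stair≢B {c} {k} a k<c () | yes _
  stair≢B {c} {k} a k<c refl | no a≮c = a≮c k<c

  opposite~B : ∀ {i j : Fin ℓ} → toℕ i < toℕ j → (A (opposite i) ~ B j) ≡ true
  opposite~B {i} {j} i<j = A~B {opposite i} {j} (begin
    ℓ                                 ≡⟨ cong suc (opposite-sum i) ⟨
    suc (toℕ (opposite i) + toℕ i)    ≡⟨ ℕ.+-suc (toℕ (opposite i)) (toℕ i) ⟨
    toℕ (opposite i) + suc (toℕ i)    ≤⟨ ℕ.+-monoʳ-≤ (toℕ (opposite i)) i<j ⟩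
    toℕ (opposite i) + toℕ j          ∎)
    where open ℕ.≤-Reasoning

  stair-clique : ∀ c {i j} → i ≢ j → (stair c i ~ stair c j) ≡ true
  stair-clique c {i} {j} i≢j with toℕ i ℕ.<? c | toℕ j ℕ.<? c
  ... | yes _   | yes _   = ≢⇒not-does s {opposite i} {opposite j} (i≢j ∘ opposite-injective)
  ... | yes i<c | no j≮c  = opposite~B {i} {j} (ℕ.<-≤-trans i<c (ℕ.≮⇒≥ j≮c))
  ... | no i≮c  | yes j<c = opposite~B {j} {i} (ℕ.<-≤-trans j<c (ℕ.≮⇒≥ i≮c))
  ... | no _    | no _    = ≢⇒not-does s {i} {j} i≢j

  -- T and all of B would be ℓ + 1 vertices; the last of B is dropped to fit ℓ positions. Positions
  -- 0 and 1 carry the edge from T to `B zero` that `A last` cannot imitate.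
  fan : Fin ℓ → Vertex ℓ
  fan zero    = T
  fan (suc k) = B (inject₁ k)

  fan-clique : ∀ {i j} → i ≢ j → (fan i ~ fan j) ≡ true
  fan-clique {zero}  {zero}  0≢0 = contradiction refl 0≢0
  fan-clique {zero}  {suc j} _   = refl
  fan-clique {suc i} {zero}  _   = refl
  fan-clique {suc i} {suc j} i≢j =
    ≢⇒not-does s {inject₁ i} {inject₁ j} (i≢j ∘ cong suc ∘ Fin.inject₁-injective)

  0q : Fin q
  0q = fromℕ< 0<q

  stairPlacement : ∀ (c : ℕ) {x y} → x ≢ y → Fin (suc r) → (Fin m → Fin q) → Placement
  stairPlacement c x≢y p z = cliquePlacement (stair c) (stair-clique c)
    (Spread.spread x≢y p z) (Spread.spread-injective x≢y p z)

  missedT : ∀ {x y} → adj F x y ≡ true → A last ≺ T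
  missedT {x} {y} xy = A≺T (imageCopy f (x , at-x))
    (image-avoids f avoids , subst (λ v → edge (image f) T v ≡ true) at-y
      (subst (λ v → edge (image f) v (Placement.at f y) ≡ true) at-x (image-edge f xy)) ,
     A≁B {last} {zero} (ℕ.≤-reflexive (cong suc (trans (ℕ.+-identityʳ _) (Fin.toℕ-fromℕ (suc r))))))
    where
    x≢y : x ≢ y
    x≢y = adj⇒≢ F xy

    f : Placement
    f = cliquePlacement fan fan-clique
      (Spread.spread x≢y zero λ _ → 0q) (Spread.spread-injective x≢y zero _)

    at-x : Placement.at f x ≡ T
    at-x = cong fan (Spread.spread-x x≢y zero _)

    at-y : Placement.at f y ≡ B zero
    at-y = cong fan (Spread.spread-y x≢y zero _)

    fan≢A : ∀ k → fan k ≢ A last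
    fan≢A zero    ()
    fan≢A (suc k) ()

    avoids : ∀ a → Placement.at f a ≢ A last
    avoids a = fan≢A _

  -- With v on D and everything else in the clique A, the neighbours of v are the only vertices
  -- whose positions matter.
  module Anchored (v : Fin m) (h : Fin m → Fin ℓ) (h-inj : ∀ {a b} → h a ≡ h b → a ≡ b)
    (low : ∀ b → adj F v b ≡ true → toℕ (h b) < s) where

    place : Fin m → Vertex ℓ
    place b = if does (b Fin.≟ v) then D else A (h b)

    place-v : place v ≡ D
    place-v rewrite dec-true (v Fin.≟ v) refl = refl

    place-other : ∀ {b} → b ≢ v → place b ≡ A (h b)
    place-other {b} b≢v rewrite dec-false (b Fin.≟ v) b≢v = refl

    place-injective : ∀ {a b} → place a ≡ place b → a ≡ b
    place-injective {a} {b} e with a Fin.≟ v | b Fin.≟ v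
    place-injective e    | yes a≡v | yes b≡v = trans a≡v (≡.sym b≡v)
    place-injective ()   | yes _   | no _
    place-injective ()   | no _    | yes _
    place-injective e    | no _    | no _    = h-inj (A-inj e)
      where
      A-inj : ∀ {i j : Fin ℓ} → A i ≡ A j → i ≡ j
      A-inj refl = refl

    place-edges : ∀ {a b} → adj F a b ≡ true → (place a ~ place b) ≡ true
    place-edges {a} {b} ab with a Fin.≟ v | b Fin.≟ v
    ... | yes refl | yes refl = contradiction refl (adj⇒≢ F ab)
    ... | yes refl | no _     = D~A {h b} (low b ab)
    ... | no _     | yes refl = D~A {h a} (low a (adj-sym F ab))
    ... | no _     | no _     = ≢⇒not-does s {h a} {h b} (adj⇒≢ F ab ∘ h-inj)

    placement : Placement
    placement = record { at = place ; injective = place-injective ; edges = place-edges }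

    place≢B : ∀ b {j} → place b ≢ B j
    place≢B b e with b Fin.≟ v
    place≢B b () | yes _
    place≢B b () | no _

    place-edge : ∀ {a b u w} → adj F a b ≡ true → place a ≡ u → place b ≡ w →
      edge (image placement) u w ≡ true
    place-edge ab refl refl = image-edge placement ab

    D∈image : mem (image placement) D ≡ true
    D∈image = subst (λ u → mem (image placement) u ≡ true) place-v (image-mem placement v)

  -- The hypothesis `single` covers both choices of s: either w is the only neighbour of v, or s = m
  -- and all neighbours of v fit below s.
  module _ {v w v′ : Fin m} (vw : adj F v w ≡ true) (wv′ : adj F w v′ ≡ true)
    (v≁v′ : adj F v v′ ≡ false) (v≢v′ : v ≢ v′)
    (diam≤2 : ∀ a b → DistLe F a b 2)
    (single : ∀ b → adj F v b ≡ true → b ≢ w → s ≡ m) where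

    ι : Fin m → Fin ℓ
    ι b = inject≤ b m≤ℓ

    ι-inj : ∀ {a b} → ι a ≡ ι b → a ≡ b
    ι-inj {a} {b} = Fin.inject≤-injective m≤ℓ m≤ℓ a b

    ι<m : ∀ b → toℕ (ι b) < m
    ι<m b = subst (_< m) (≡.sym (Fin.toℕ-inject≤ b m≤ℓ)) (Fin.toℕ<n b)

    allB≺A : ∀ i → B i ≺ A i
    allB≺A i with toℕ i ℕ.<? s
    -- The edge that `B i` lacks is the one from `A i` to D, here the image of the edge between w
    -- and v.
    ... | yes i<s = B≺A diam≤2 i (imageCopy placement (w , at-w)) D∈image
      (D , image-avoids placement (λ b → place≢B b) , place-edge (adj-sym F vw) at-w place-v , refl)
      where
      h : Fin m → Fin ℓ
      h = swap Fin._≟_ (ι w) i ∘ ι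

      h-w : h w ≡ i
      h-w = swap-left Fin._≟_ (ι w) i

      low : ∀ b → adj F v b ≡ true → toℕ (h b) < s
      low b vb with b Fin.≟ w
      ... | yes refl = subst (λ k → toℕ k < s) (≡.sym h-w) i<s
      ... | no b≢w with refl ← single b vb b≢w =
        swap-closed Fin._≟_ (λ k → toℕ k < s) (ι<m w) i<s (ι<m b)

      open Anchored v h (ι-inj ∘ swap-injective Fin._≟_ (ι w) i) low

      at-w : place w ≡ A i
      at-w = trans (place-other (adj⇒≢ F (adj-sym F vw))) (cong A h-w)
    -- Now `A i` is not adjacent to D, and the edge that `B i` lacks leads to `A zero`. As v′ is no
    -- neighbour of v, it can be placed on `A i`, with w on `A zero`; the neighbours of v stay below
    -- s and are not moved by the second swap.
    ... | no i≮s = B≺A diam≤2 i (imageCopy placement (v′ , at-v′)) D∈image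
      (A zero , image-avoids placement (λ b → place≢B b) , place-edge (adj-sym F wv′) at-v′ at-w ,
       trans (adjacent-sym s (B i) (A zero)) (A₀≁B i))
      where
      g h : Fin m → Fin ℓ
      g = swap Fin._≟_ (ι w) zero ∘ ι
      h = swap Fin._≟_ (g v′) i ∘ g

      g-inj : ∀ {a b} → g a ≡ g b → a ≡ b
      g-inj = ι-inj ∘ swap-injective Fin._≟_ (ι w) zero

      g-w : g w ≡ zero
      g-w = swap-left Fin._≟_ (ι w) zero

      g≢i : ∀ b → toℕ (g b) < s → g b ≢ i
      g≢i b gb<s refl = i≮s gb<s

      h-w : h w ≡ zero
      h-w = trans (swap-other Fin._≟_ (g v′) i (adj⇒≢ F wv′ ∘ g-inj)
        (g≢i w (subst (λ k → toℕ k < s) (≡.sym g-w) 0<s))) g-w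

      low : ∀ b → adj F v b ≡ true → toℕ (h b) < s
      low b vb with b Fin.≟ w
      ... | yes refl = subst (λ k → toℕ k < s) (≡.sym h-w) 0<s
      ... | no b≢w with refl ← single b vb b≢w = subst (λ k → toℕ k < s)
          (≡.sym (swap-other Fin._≟_ (g v′) i (b≢v′ ∘ g-inj) (g≢i b gb<s))) gb<s
        where
        b≢v′ : b ≢ v′
        b≢v′ refl = true≢false vb v≁v′

        gb<s : toℕ (g b) < s
        gb<s = swap-closed Fin._≟_ (λ k → toℕ k < s) (ι<m w) 0<s (ι<m b)

      open Anchored v h (g-inj ∘ swap-injective Fin._≟_ (g v′) i) low

      at-w : place w ≡ A zero
      at-w = trans (place-other (adj⇒≢ F (adj-sym F vw))) (cong A h-w)

      at-v′ : place v′ ≡ A i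
      at-v′ = trans (place-other (v≢v′ ∘ ≡.sym)) (cong A (swap-left Fin._≟_ (g v′) i))

  D-nbr : ∀ u → (D ~ u) ≡ true → ∃[ i ] (u ≡ A i × toℕ i < s)
  D-nbr (A i) e = i , refl , D~A⁻ {i} e

  -- The two configurations in which copies through D are outnumbered: Gain (c = p + 1, a Step)
  -- and the copies at B zero (c = 0).
  stairCopy-unshifted : ∀ p {x y} (xy : adj F x y ≡ true) z →
    let f = stairPlacement (suc (toℕ p)) (adj⇒≢ F xy) p z in
    Placement.at f x ≡ Step.apex p × Placement.at f y ≡ B (suc p) ×
    Step.Unshifted p (image f) (Step.apex p)
  stairCopy-unshifted p {x} {y} xy z = at-x , at-y ,
    image-avoids f (λ a → stair≢B {suc (toℕ p)} {inject₁ p} _ p<c) ,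
    ≡.subst₂ (λ u w → edge (image f) u w ≡ true) at-y at-x (image-edge f (adj-sym F xy)) ,
    Step.B≁apex p
    where
    x≢y : x ≢ y
    x≢y = adj⇒≢ F xy

    f : Placement
    f = stairPlacement (suc (toℕ p)) x≢y p z

    p<c : toℕ (inject₁ p) < suc (toℕ p)
    p<c = ℕ.≤-reflexive (cong suc (Fin.toℕ-inject₁ p))

    at-x : Placement.at f x ≡ Step.apex p
    at-x = trans (cong (stair _) (Spread.spread-x x≢y p z)) (stair-A p<c)

    at-y : Placement.at f y ≡ B (suc p)
    at-y = trans (cong (stair _) (Spread.spread-y x≢y p z)) (stair-B {suc (toℕ p)} {suc p} ℕ.≤-refl)

  stairCopy-B₀ : ∀ {x y} (x≢y : x ≢ y) z → Placement.at (stairPlacement 0 x≢y zero z) x ≡ B zero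
  stairCopy-B₀ x≢y z = trans (cong (stair 0) (Spread.spread-x x≢y zero z)) (stair-B z≤n)

  -- Copies through D

  data InAT : Vertex ℓ → Set where
    A∈ : ∀ i → InAT (A i)
    T∈ : InAT T

  AT-clique : ∀ {u w} → InAT u → InAT w → u ≢ w → (u ~ w) ≡ true
  AT-clique (A∈ i) (A∈ j) u≢w = ≢⇒not-does s {i} {j} (u≢w ∘ cong A)
  AT-clique (A∈ i) T∈     _   = refl
  AT-clique T∈     (A∈ i) _   = refl
  AT-clique T∈     T∈     T≢T = contradiction refl T≢T

  AT≢D : ∀ {u} → InAT u → u ≢ D
  AT≢D (A∈ _) ()
  AT≢D T∈     ()

  AT≢B : ∀ {u j} → InAT u → u ≢ B j
  AT≢B (A∈ _) ()
  AT≢B T∈     ()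

  -- When D has the single neighbour A zero, a copy through D uses D as a leaf; as it has diameter
  -- at most 2, it lies in the clique on the A and T apart from D.
  module Leaf (s≡1 : s ≡ 1) (diam≤2 : ∀ a b → DistLe F a b 2)
    {v w v′ : Fin m} (vw : adj F v w ≡ true) (wv′ : adj F w v′ ≡ true) (v≢v′ : v ≢ v′) where

    D-leaf : ∀ u → (D ~ u) ≡ true → u ≡ A zero
    D-leaf u Du with D-nbr u Du
    ... | zero  , u≡A , _   = u≡A
    ... | suc i , _   , i<s = contradiction (subst (suc (toℕ i) <_) s≡1 i<s) λ { (s≤s ()) }

    -- A common neighbour of D and `B j` could only be `A zero`, which has no neighbour in B.
    avoids-B : (P : Copy D) → ∀ j → mem (host P) (B j) ≢ true
    avoids-B P j Bj∈P with reach diam≤2 P {j} (memb P) Bj∈P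
    ... | zero  , _   , ℓ≤j = ℕ.<⇒≱ (Fin.toℕ<n j) ℓ≤j
    ... | suc l , l<s , _   = contradiction (subst (suc l <_) s≡1 l<s) λ { (s≤s ()) }

    member : (P : Copy D) → ∀ u → mem (host P) u ≡ true → u ≡ D ⊎ InAT u
    member P (A i) _   = inj₂ (A∈ i)
    member P (B j) B∈P = contradiction B∈P (avoids-B P j)
    member P T     _   = inj₂ T∈
    member P D     _   = inj₁ refl

    neighbour : ∀ a → ∃[ b ] adj F a b ≡ true
    neighbour a with a Fin.≟ v
    ... | yes refl = w , vw
    ... | no a≢v with diam≤2 a v
    ...   | _ , _ , here        = contradiction refl a≢v
    ...   | _ , _ , step ab _   = _ , ab

    -- F has no isolated vertex, so D has a neighbour within the copy.
    D-A₀ : (P : Copy D) → edge (host P) D (A zero) ≡ true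
    D-A₀ P with embedding P
    ... | e with Embedding.onto e (memb P)
    ...   | a , at-a with neighbour a
    ...     | b , ab = subst (λ u → edge (host P) D u ≡ true) (D-leaf _ (edge⇒~ (host P) Db)) Db
      where
      Db : edge (host P) D (Embedding.at e b) ≡ true
      Db = subst (λ u → edge (host P) u (Embedding.at e b) ≡ true) at-a
        (trans (≡.sym (Embedding.edges e a b)) ab)

    -- D is moved to `B j` and its neighbour `A zero` to α, while the rest stays in the clique on A
    -- and T. The only edge that leaves this clique joins D to `A zero` and becomes the edge from
    -- `B j` to α.
    module Rotate (j : Fin ℓ) {α : Vertex ℓ} (α∈ : InAT α) (B~α : (B j ~ α) ≡ true) where

      π : Vertex ℓ ↔ Vertex ℓ
      π = swap↔ _≟_ (A zero) α ↔-∘ swap↔ _≟_ D (B j)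

      open Inverse π using (to; from; strictlyInverseʳ)

      to-D : to D ≡ B j
      to-D = trans (cong (swap _≟_ (A zero) α) (swap-left _≟_ D (B j)))
        (swap-other _≟_ (A zero) α (λ ()) (AT≢B α∈ ∘ ≡.sym))

      to-AT : ∀ {u} → InAT u → to u ≡ swap _≟_ (A zero) α u
      to-AT u∈ = cong (swap _≟_ (A zero) α) (swap-other _≟_ D (B j) (AT≢D u∈) (AT≢B u∈))

      to-A₀ : to (A zero) ≡ α
      to-A₀ = trans (to-AT (A∈ zero)) (swap-left _≟_ (A zero) α)

      to∈AT : ∀ {u} → InAT u → InAT (to u)
      to∈AT u∈ = subst InAT (≡.sym (to-AT u∈)) (swap-closed _≟_ InAT (A∈ zero) α∈ u∈)

      to-injective : ∀ {u u′} → to u ≡ to u′ → u ≡ u′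
      to-injective = Injection.injective (↔⇒↣ π)

      to-D~ : ∀ u → (D ~ u) ≡ true → (to D ~ to u) ≡ true
      to-D~ u Du with refl ← D-leaf u Du = trans (cong₂ _~_ to-D to-A₀) B~α

      preserves : (P : Copy D) → PreservesEdges π (host P)
      preserves P x y xy
        with member P x (edge⇒memˡ (host P) xy) | member P y (edge⇒memʳ (host P) xy)
      ... | inj₁ refl | _         = to-D~ y (edge⇒~ (host P) xy)
      ... | inj₂ _    | inj₁ refl = trans (adjacent-sym s (to x) (to D))
        (to-D~ x (edge⇒~ (host P) (edge-sym (host P) xy)))
      ... | inj₂ x∈   | inj₂ y∈   = AT-clique (to∈AT x∈) (to∈AT y∈) λ e →
        true≢false (edge⇒~ (host P) xy)
          (subst (λ y → (x ~ y) ≡ false) (to-injective e) (adjacent-irrefl s x))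

      from-B : from (B j) ≡ D
      from-B = trans (cong from (≡.sym to-D)) (strictlyInverseʳ D)

      from-α : from α ≡ A zero
      from-α = trans (cong from (≡.sym to-A₀)) (strictlyInverseʳ (A zero))

      rotate : Copy D → Copy (B j)
      rotate P = relabelCopy π P (preserves P) from-B

      rotate-injective : ∀ P P′ → rotate P ≡ rotate P′ → P ≡ P′
      rotate-injective P@(copy _ _ _) P′@(copy _ _ _) e = copy-ext
        (relabel-injective π {ok = preserves P} {ok′ = preserves P′} (cong host e))

      rotate-edge : ∀ P u u′ → edge (host (rotate P)) u u′ ≡ edge (host P) (from u) (from u′)
      rotate-edge P@(copy _ _ _) = edge-relabel π (host P) (preserves P)

      rotate-mem : ∀ P u → mem (host (rotate P)) u ≡ mem (host P) (from u)
      rotate-mem P@(copy _ _ _) = mem-relabel π (host P) (preserves P)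

      rotate-α : ∀ P → edge (host (rotate P)) (B j) α ≡ true
      rotate-α P = trans (rotate-edge P (B j) α) (trans (cong₂ (edge (host P)) from-B from-α) (D-A₀ P))

      rotate-leaf : ∀ P u → edge (host (rotate P)) (B j) u ≡ true → u ≡ α
      rotate-leaf P u e = begin
        u            ≡⟨ Inverse.strictlyInverseˡ π u ⟨
        to (from u)  ≡⟨ cong to (D-leaf (from u) (edge⇒~ (host P) edge-D)) ⟩
        to (A zero)  ≡⟨ to-A₀ ⟩
        α            ∎
        where
        open ≡.≡-Reasoning
        edge-D : edge (host P) D (from u) ≡ true
        edge-D = subst (λ x → edge (host P) x (from u) ≡ true) from-B
          (trans (≡.sym (rotate-edge P (B j) u)) e)

      rotate-avoids : ∀ P {i} → i ≢ j → mem (host (rotate P)) (B i) ≡ false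
      rotate-avoids P {i} i≢j = bool-ext
        (λ p → contradiction (trans (cong (mem (host P)) (≡.sym from-Bi)) (trans (≡.sym (rotate-mem P (B i))) p))
          (avoids-B P i))
        (λ ())
        where
        from-Bi : from (B i) ≡ B i
        from-Bi = trans
          (cong (swap _≟_ D (B j)) (swap-other _≟_ (A zero) α (λ ()) (AT≢B α∈ ∘ ≡.sym)))
          (swap-other _≟_ D (B j) (λ ()) λ { refl → i≢j refl })

      -- In a rotated copy B j is a leaf.
      rotate-misses : ∀ (f : Placement) → Placement.at f w ≡ B j →
        ∀ P (Q : Copy (B j)) → host Q ≡ image f → rotate P ≢ Q
      rotate-misses f at-w P Q Q≡f e =
        v≢v′ (Placement.injective f (trans (at≡α (adj-sym F vw)) (≡.sym (at≡α wv′))))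
        where
        at≡α : ∀ {b} → adj F w b ≡ true → Placement.at f b ≡ α
        at≡α {b} wb = rotate-leaf P _ (subst (λ K → edge K (B j) (Placement.at f b) ≡ true)
          (≡.sym (trans (cong host e) Q≡f))
          (subst (λ u → edge (image f) u (Placement.at f b) ≡ true) at-w (image-edge f wb)))

    D≺B₀ : D ≺ B zero
    D≺B₀ = adjoin Q rotate rotate-injective λ P → rotate-misses f at-w P Q refl
      where
      -- T is the only possible α, since `B zero` has no neighbour in A.
      open Rotate zero T∈ refl

      w≢v : w ≢ v
      w≢v = adj⇒≢ F (adj-sym F vw)

      f : Placement
      f = stairPlacement 0 w≢v zero λ _ → 0q

      at-w : Placement.at f w ≡ B zero
      at-w = stairCopy-B₀ w≢v _

      Q : Copy (B zero)
      Q = imageCopy f (w , at-w)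

    gain : ∀ p → Step.Gain p
    gain p = record
      { to        = Injection.to extended
      ; injective = Injection.injective extended
      ; unshifted = λ
          { nothing  → stairCopy-unshifted p vw _ .proj₂ .proj₂
          ; (just P) → rotate-avoids P (inject₁≢suc p) , rotate-α P , Step.B≁apex p
          }
      }
      where
      open Rotate (suc p) (A∈ (opposite (inject₁ p)))
        (opposite~B {inject₁ p} {suc p} (ℕ.≤-reflexive (cong suc (Fin.toℕ-inject₁ p))))

      -- The orientation matters: v goes to the apex, and w, which has two neighbours, to
      -- `B (suc p)`, so that the latter is no leaf of this copy.
      f : Placement
      f = stairPlacement (suc (toℕ p)) (adj⇒≢ F vw) p λ _ → 0q

      at-w : Placement.at f w ≡ B (suc p)
      at-w = stairCopy-unshifted p vw _ .proj₂ .proj₁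

      Q : Copy (B (suc p))
      Q = imageCopy f (w , at-w)

      extended : Maybe (Copy D) ↣ Copy (B (suc p))
      extended = adjoin Q rotate rotate-injective λ P → rotate-misses f at-w P Q refl

  -- Without leaves, a copy through D has two further vertices among the s neighbours of D, so
  -- there are fewer such copies than copies within a stair that contain a prescribed edge.
  module NoLeaf {k : ℕ} (m≡ : m ≡ 3 + k)
    (two : ∀ a → ∃[ b ] ∃[ c ] (b ≢ c × adj F a b ≡ true × adj F a c ≡ true))
    (room : m * (m * (m * (s * (s * (2 + (ℓ + ℓ)) ℕ.^ k)))) < q ℕ.^ suc k) where

    -- The data that code a copy: the vertex a of F on D and two neighbours of a are recorded as
    -- vertices of F, the positions of these neighbours by numbers below s. Only the other k
    -- vertices range over the whole graph.
    record Trace (P : Copy D) : Set where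
      constructor trace
      open Embedding (embedding P) public
      field
        {a b c} : Fin m
        a≢b     : a ≢ b
        a≢c     : a ≢ c
        b≢c     : b ≢ c
        {i j}   : Fin s
        at-a    : at a ≡ D
        at-b    : at b ≡ A (inject≤ i (ℕ.<⇒≤ s<ℓ))
        at-c    : at c ≡ A (inject≤ j (ℕ.<⇒≤ s<ℓ))

      others : Fin ((2 + (ℓ + ℓ)) ℕ.^ k)
      others = funToFin (code ∘ at ∘ omit₃ m≡ a≢b a≢c b≢c)

      number : Fin (m * (m * (m * (s * (s * (2 + (ℓ + ℓ)) ℕ.^ k)))))
      number = combine a (combine b (combine c (combine i (combine j others))))

    low-A : ∀ u → (D ~ u) ≡ true → ∃[ i ] u ≡ A (inject≤ {s} i (ℕ.<⇒≤ s<ℓ))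
    low-A u Du with D-nbr u Du
    ... | i , refl , i<s = fromℕ< i<s , cong A (Fin.toℕ-injective
      (≡.sym (trans (Fin.toℕ-inject≤ (fromℕ< i<s) (ℕ.<⇒≤ s<ℓ)) (Fin.toℕ-fromℕ< i<s))))

    traceOf : ∀ P → Trace P
    traceOf P = record
      { a≢b = adj⇒≢ F ab ; a≢c = adj⇒≢ F ac ; b≢c = b≢c
      ; at-a = at-a ; at-b = low-A _ (D~ ab) .proj₂ ; at-c = low-A _ (D~ ac) .proj₂ }
      where
      open Embedding (embedding P)
      a = onto (memb P) .proj₁
      at-a = onto (memb P) .proj₂
      b = two a .proj₁
      c = two a .proj₂ .proj₁
      b≢c = two a .proj₂ .proj₂ .proj₁
      ab = two a .proj₂ .proj₂ .proj₂ .proj₁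
      ac = two a .proj₂ .proj₂ .proj₂ .proj₂

      D~ : ∀ {x} → adj F a x ≡ true → (D ~ at x) ≡ true
      D~ {x} ax = subst (λ u → (u ~ at x) ≡ true) at-a
        (edge⇒~ (host P) (trans (≡.sym (edges a x)) ax))

    number-determines : ∀ {P P′} (t : Trace P) (t′ : Trace P′) →
      Trace.number t ≡ Trace.number t′ → P ≡ P′
    number-determines {P} {P′}
      t@(trace {a} {b} {c} a≢b a≢c b≢c {i} {j} at-a at-b at-c)
      t′@(trace {a′} {b′} {c′} _ _ _ {i′} {j′} at-a′ at-b′ at-c′) e
      = copy-ext (host-determined P P′ (at≡ (split₁ .proj₁) (split₂ .proj₁) (split₃ .proj₁)
          (split₄ .proj₁) (split₅ .proj₁) (split₅ .proj₂)))
      where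
      open Trace using (at)

      split₁ = Fin.combine-injective a (combine b (combine c (combine i (combine j (Trace.others t)))))
        a′ (combine b′ (combine c′ (combine i′ (combine j′ (Trace.others t′))))) e
      split₂ = Fin.combine-injective b (combine c (combine i (combine j (Trace.others t))))
        b′ (combine c′ (combine i′ (combine j′ (Trace.others t′)))) (split₁ .proj₂)
      split₃ = Fin.combine-injective c (combine i (combine j (Trace.others t)))
        c′ (combine i′ (combine j′ (Trace.others t′))) (split₂ .proj₂)
      split₄ = Fin.combine-injective i (combine j (Trace.others t))
        i′ (combine j′ (Trace.others t′)) (split₃ .proj₂)
      split₅ = Fin.combine-injective j (Trace.others t) j′ (Trace.others t′) (split₄ .proj₂)

      at≡ : a ≡ a′ → b ≡ b′ → c ≡ c′ → i ≡ i′ → j ≡ j′ → Trace.others t ≡ Trace.others t′ →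
        ∀ x → at t x ≡ at t′ x
      at≡ refl refl refl refl refl e x with omit₃-cover m≡ a≢b a≢c b≢c x
      ... | inj₁ refl                      = trans at-a (≡.sym at-a′)
      ... | inj₂ (inj₁ refl)               = trans at-b (≡.sym at-b′)
      ... | inj₂ (inj₂ (inj₁ refl))        = trans at-c (≡.sym at-c′)
      ... | inj₂ (inj₂ (inj₂ (y , refl))) = enc-injective (begin
        code (at t (rest y))           ≡⟨ Fin.finToFun-funToFin (code ∘ at t ∘ rest) y ⟨
        finToFun (Trace.others t) y    ≡⟨ cong (λ o → finToFun o y) e ⟩
        finToFun (Trace.others t′) y   ≡⟨ Fin.finToFun-funToFin (code ∘ at t′ ∘ rest) y ⟩
        code (at t′ (rest y))          ∎)
        where
        open ≡.≡-Reasoning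
        rest = omit₃ m≡ a≢b a≢c b≢c

    -- The strict inequality in `room` leaves the label zero for `nothing`.
    label : Maybe (Copy D) → Fin (q ℕ.^ suc k)
    label nothing  = inject≤ zero room
    label (just P) = inject≤ (suc (Trace.number (traceOf P))) room

    label-injective : ∀ {x y} → label x ≡ label y → x ≡ y
    label-injective {x} {y} e = raw-injective (Fin.inject≤-injective room room (raw x) (raw y) (raw≡ x y e))
      where
      raw : Maybe (Copy D) → Fin (suc (m * (m * (m * (s * (s * (2 + (ℓ + ℓ)) ℕ.^ k))))))
      raw nothing  = zero
      raw (just P) = suc (Trace.number (traceOf P))

      raw≡ : ∀ x y → label x ≡ label y → inject≤ (raw x) room ≡ inject≤ (raw y) room
      raw≡ nothing  nothing  e = e
      raw≡ nothing  (just _) e = e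
      raw≡ (just _) nothing  e = e
      raw≡ (just _) (just _) e = e

      raw-injective : ∀ {x y} → raw x ≡ raw y → x ≡ y
      raw-injective {nothing} {nothing} _ = refl
      raw-injective {just P}  {just P′} e =
        cong just (number-determines (traceOf P) (traceOf P′) (Fin.suc-injective e))

    module _ {x y : Fin m} (x≢y : x ≢ y) where

      -- The label written in base q has k + 1 digits, one for each vertex of F other than x and y;
      -- the digit selects the place within the block of that vertex.
      spots : Maybe (Copy D) → Fin m → Fin q
      spots t = extend₂ m≡ x≢y 0q (finToFun (label t))

      spots-injective : ∀ c p t t′ →
        image (stairPlacement c x≢y p (spots t)) ≡ image (stairPlacement c x≢y p (spots t′)) → t ≡ t′
      spots-injective c p t t′ e = label-injective (finToFun-injective λ j → begin
        finToFun (label t) j            ≡⟨ extend₂-omit₂ m≡ x≢y 0q (finToFun (label t)) j ⟨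
        spots t (omit₂ m≡ x≢y j)        ≡⟨ spots≡ (omit₂≢ˡ m≡ x≢y j) (omit₂≢ʳ m≡ x≢y j) ⟩
        spots t′ (omit₂ m≡ x≢y j)       ≡⟨ extend₂-omit₂ m≡ x≢y 0q (finToFun (label t′)) j ⟩
        finToFun (label t′) j           ∎)
        where
        open ≡.≡-Reasoning

        f f′ : Placement
        f  = stairPlacement c x≢y p (spots t)
        f′ = stairPlacement c x≢y p (spots t′)

        spots≡ : ∀ {a} → a ≢ x → a ≢ y → spots t a ≡ spots t′ a
        spots≡ {a} a≢x a≢y =
          let (b , e) = image-onto f′ (subst (λ K → mem K (Placement.at f a) ≡ true) e (image-mem f a))
          in Spread.spread-determines x≢y p (spots t) (spots t′)
               {b = b} (≡.sym (clique-injective (stair c) (stair-clique c) e)) .proj₂ a≢x a≢y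

    D≺B₀ : ∀ {x y} → adj F x y ≡ true → D ≺ B zero
    D≺B₀ {x} xy = mk↣ {to = to} λ {t} {t′} e → spots-injective x≢y 0 zero t t′ (cong host e)
      where
      x≢y = adj⇒≢ F xy

      to : Maybe (Copy D) → Copy (B zero)
      to t = imageCopy (stairPlacement 0 x≢y zero (spots x≢y t)) (x , stairCopy-B₀ x≢y _)

    gain : ∀ {x y} → adj F x y ≡ true → ∀ p → Step.Gain p
    gain {x} {y} xy p = record
      { to        = λ t → imageCopy (stairPlacement (suc (toℕ p)) x≢y p (spots x≢y t))
          (y , stairCopy-unshifted p xy (spots x≢y t) .proj₂ .proj₁)
      ; injective = λ {t} {t′} e → spots-injective x≢y (suc (toℕ p)) p t t′ (cong host e)
      ; unshifted = λ t → stairCopy-unshifted p xy (spots x≢y t) .proj₂ .proj₂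
      }
      where
      x≢y = adj⇒≢ F xy

-- The infinite family

Family : Graph → Set
Family F = Σ (ℕ → Graph) λ Gs →
  (∀ i → HasDiameter (Gs i) 3 × FIrregular F (Gs i)) ×
  (∀ i j → i ≢ j → ¬ (Gs i ≅ Gs j))

-- In q = 2 + c + i, c is a threshold beyond which the count succeeds and i numbers the members. The
-- summand 2 ensures 2 * m ≤ m * q, as needed for s = m. The vertex v shows that `n F` is positive,
-- so that different i give different orders.
module Members (F : Graph) (s c : ℕ) (0<s : 0 < s)
  (2s≤ : ∀ i → s + s ≤ 2 + n F * (2 + c + i)) (v : Fin (n F)) where

  module At (i : ℕ) = Construction F (2 + c + i) s (s≤s z≤n) 0<s (2s≤ i)

  member : ℕ → Graph
  member i = At.G i

  member-distinct : ∀ i j → i ≢ j → ¬ (member i ≅ member j)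
  member-distinct i j i≢j iso = i≢j (ℕ.+-cancelˡ-≡ (2 + c) i j
    (ℕ.*-cancelˡ-≡ (2 + c + i) (2 + c + j) (n F) {{nonZero v}}
      (ℕ.+-cancelˡ-≡ 2 _ _ (n+n-injective (ℕ.+-cancelˡ-≡ 2 _ _ (↔⇒≡ (_≅_.bij iso)))))))
    where
    nonZero : ∀ {k} → Fin k → ℕ.NonZero k
    nonZero {suc k} _ = _

module _ (F : Graph) (diam≤2 : ∀ a b → DistLe F a b 2) where

  Leaf : Fin (n F) → Fin (n F) → Set
  Leaf v w = adj F v w ≡ true × (∀ x → adj F v x ≡ true → x ≡ w)

  leaf? : Dec (∃[ v ] ∃[ w ] Leaf v w)
  leaf? = any? λ v → any? λ w →
    (adj F v w Bool.≟ true) ×-dec (all? λ x → (adj F v x Bool.≟ true) →-dec (x Fin.≟ w))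

  has-neighbour : ∀ {v w} → adj F v w ≡ true → ∀ a → ∃[ b ] adj F a b ≡ true
  has-neighbour {v} {w} vw a with diam≤2 a v
  ... | _ , _ , here      = w , vw
  ... | _ , _ , step ab _ = _ , ab

  two-neighbours : ¬ (∃[ v ] ∃[ w ] Leaf v w) → ∀ {v w} → adj F v w ≡ true →
    ∀ a → ∃[ b ] ∃[ c ] (b ≢ c × adj F a b ≡ true × adj F a c ≡ true)
  two-neighbours leafless vw a with has-neighbour vw a
  ... | b , ab with any? (λ c → (adj F a c Bool.≟ true) ×-dec ¬? (b Fin.≟ c))
  ...   | yes (c , ac , b≢c) = b , c , b≢c , ab , ac
  ...   | no none = contradiction (a , b , ab , only) leafless
    where
    only : ∀ x → adj F a x ≡ true → x ≡ b
    only x ax with b Fin.≟ x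
    ... | yes b≡x = ≡.sym b≡x
    ... | no b≢x  = contradiction (x , ax , b≢x) none

  -- Every walk from a leaf starts with its neighbour w, so diameter 2 makes w adjacent to all other
  -- vertices.
  leaf-opposite : ∀ {v w} → Leaf v w → ∀ {x} → x ≢ v → x ≢ w →
    adj F w x ≡ true × adj F v x ≡ false
  leaf-opposite {v} {w} (vw , only) {x} x≢v x≢w =
    second , bool-ext (λ vx → contradiction (only x vx) x≢w) λ ()
    where
    second : adj F w x ≡ true
    second with diam≤2 v x
    ... | _ , _ , here            = contradiction refl x≢v
    ... | _ , _ , step vx here    = contradiction (only x vx) x≢w
    ... | _ , _ , step vy (step yx here) = subst (λ y → adj F y x ≡ true) (only _ vy) yx
    ... | _ , s≤s (s≤s ()) , step _ (step _ (step _ _))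

  -- As v and w are adjacent, the non-adjacent pair a, b cannot consist of these two.
  leaf-third : ∀ {v w} → Leaf v w → ∀ {a b} → a ≢ b → adj F a b ≡ false → ∃[ x ] (x ≢ v × x ≢ w)
  leaf-third {v} {w} (vw , _) {a} {b} a≢b a≁b with a Fin.≟ v | a Fin.≟ w | b Fin.≟ v | b Fin.≟ w
  ... | no a≢v   | no a≢w   | _        | _        = a , a≢v , a≢w
  ... | _        | _        | no b≢v   | no b≢w   = b , b≢v , b≢w
  ... | yes refl | _        | yes refl | _        = contradiction refl a≢b
  ... | yes refl | _        | no _     | yes refl = ⊥-elim (true≢false vw a≁b)
  ... | no _     | yes refl | yes refl | _        = ⊥-elim (true≢false (trans (sym F w v) vw) a≁b)
  ... | no _     | yes refl | no _     | yes refl = contradiction refl a≢b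

  module _ {v v′ : Fin (n F)} (v≢v′ : v ≢ v′) (v≁v′ : adj F v v′ ≡ false) where

    leafFamily : ∀ {x w} → Leaf x w → Family F
    leafFamily {x} {w} leaf@(xw , only) with leaf-third leaf v≢v′ v≁v′
    ... | x′ , x′≢x , x′≢w with leaf-opposite leaf x′≢x x′≢w
    ...   | wx′ , x≁x′ = member , (λ i → At.G-diameter i , irregularAt i) , member-distinct
      where
      open Members F 1 0 (s≤s z≤n) (λ i → s≤s (s≤s z≤n)) x

      irregularAt : ∀ i → FIrregular F (member i)
      irregularAt i = irregular L.D≺B₀
        (allB≺A xw wx′ x≁x′ (x′≢x ∘ ≡.sym) diam≤2 λ b xb b≢w → contradiction (only b xb) b≢w)
        (λ p → Step.A≺B p (L.gain p)) (missedT xw)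
        where
        open At i
        module L = Leaf refl diam≤2 xw wx′ (x′≢x ∘ ≡.sym)

    leaflessFamily : ¬ (∃[ x ] ∃[ w ] Leaf x w) → ∀ {w} →
      adj F v w ≡ true → adj F w v′ ≡ true → Family F
    leaflessFamily leafless {w} vw wv′ =
      member , (λ i → At.G-diameter i , irregularAt i) , member-distinct
      where
      two : ∀ a → ∃[ b ] ∃[ c ] (b ≢ c × adj F a b ≡ true × adj F a c ≡ true)
      two = two-neighbours leafless vw

      size : ∃[ k ] n F ≡ 3 + k
      size = three-distinct (adj⇒≢ F vw) v≢v′ (adj⇒≢ F wv′)

      k c : ℕ
      k = size .proj₁
      -- This is the constant that q has to exceed in `roomy`.
      c = times⁵ (n F) ((6 + (n F + n F)) ℕ.^ k)

      0<m : 0 < n F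
      0<m = subst (0 <_) (≡.sym (size .proj₂)) (s≤s z≤n)

      2m≤ : ∀ i → n F + n F ≤ 2 + n F * (2 + c + i)
      2m≤ i = begin
        n F + n F                ≡⟨ cong (n F +_) (ℕ.+-identityʳ (n F)) ⟨
        2 * n F                  ≡⟨ ℕ.*-comm 2 (n F) ⟩
        n F * 2                  ≤⟨ ℕ.*-monoʳ-≤ (n F) (s≤s (s≤s z≤n)) ⟩
        n F * (2 + c + i)        ≤⟨ ℕ.m≤n+m _ 2 ⟩
        2 + n F * (2 + c + i)    ∎
        where open ℕ.≤-Reasoning

      open Members F (n F) c 0<m 2m≤ v

      irregularAt : ∀ i → FIrregular F (member i)
      irregularAt i = irregular (L.D≺B₀ vw)
        (allB≺A vw wv′ v≁v′ v≢v′ diam≤2 λ _ _ _ → refl)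
        (λ p → Step.A≺B p (L.gain vw p)) (missedT vw)
        where
        open At i
        module L = NoLeaf (size .proj₂) two
          (roomy (n F) k (2 + c + i) (ℕ.≤-trans (ℕ.n≤1+n (suc c)) (ℕ.m≤m+n (2 + c) i)))

theorem4 : (F : Graph) → HasDiameter F 2 →
    Σ (ℕ → Graph) λ Gs →
    (∀ i → HasDiameter (Gs i) 3 × FIrregular F (Gs i)) ×
    (∀ i j → i ≢ j → ¬ (Gs i ≅ Gs j))
theorem4 F (diam≤2 , v , v′ , far) with diam≤2 v v′ | leaf? F diam≤2
... | _ , _ , here          | _ = contradiction (far 0 here) λ ()
... | _ , _ , step vv′ here | _ = contradiction (far 1 (step vv′ here)) λ { (s≤s ()) }
... | _ , s≤s (s≤s ()) , step _ (step _ (step _ _)) | _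
-- Without a leaf, the path from v over w to v′ is used directly. Otherwise the pair v, v′ only
-- supplies a third vertex besides a leaf and its neighbour, and the path starts at the leaf.
... | _ , _ , step vw (step wv′ here) | leaf =
  [ (λ (_ , _ , l) → leafFamily F diam≤2 v≢v′ v≁v′ l)
  , (λ leafless → leaflessFamily F diam≤2 v≢v′ v≁v′ leafless vw wv′)
  ]′ (toSum leaf)
  where
  v≢v′ : v ≢ v′
  v≢v′ refl = contradiction (far 0 here) λ ()

  v≁v′ : adj F v v′ ≡ false
  v≁v′ = bool-ext (λ e → contradiction (far 1 (step e here)) λ { (s≤s ()) }) λ ()
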